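{- Up to equivalence, there are exactly $5$ weighing matrices of order $12$ and weight $10$.
   Context: A weighing matrix of order $n$ and weight $k$ is an $n\times n$ matrix $W$ with entries in $\{1,-1,0\}$ such that $WW^T=kI_n$. Two weighing matrices $W_1,W_2$ of order $n$ are equivalent if $W_1=PW_2Q$ for some $n\times n$ monomial matrices $P,Q$ with nonzero entries in $\{1,-1\}$. -}

module Defs where

open import Data.Nat using (ℕ; zero; suc)
open import Data.Fin using (Fin; zero; suc; _≟_)
open import Relation.Nullary using (yes; no)
open import Data.Integer using (ℤ; +_; -[1+_]; _+_; _*_)
open import Data.Product using (Σ; ∃; _×_; _,_)
open import Data.Sum using (_⊎_)
open import Relation.Binary.PropositionalEquality using (_≡_; _≢_)

Matrix : ℕ → Set
Matrix n = Fin n → Fin n → ℤ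

sumFin : (n : ℕ) → (Fin n → ℤ) → ℤ
sumFin zero    f = + 0
sumFin (suc n) f = f zero + sumFin n (λ i → f (suc i))

_⊗_ : {n : ℕ} → Matrix n → Matrix n → Matrix n
_⊗_ {n} A B i j = sumFin n (λ l → A i l * B l j)

transpose : {n : ℕ} → Matrix n → Matrix n
transpose A i j = A j i

scalarId : (n : ℕ) → ℤ → Matrix n
scalarId n k i j with i ≟ j
... | yes _ = k
... | no  _ = + 0

_≡ᴹ_ : {n : ℕ} → Matrix n → Matrix n → Set
A ≡ᴹ B = ∀ i j → A i j ≡ B i j

IsSignOrZero : ℤ → Set
IsSignOrZero x = (x ≡ + 1) ⊎ (x ≡ -[1+ 0 ]) ⊎ (x ≡ + 0)

IsWeighing : (n k : ℕ) → Matrix n → Set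
IsWeighing n k W = (∀ i j → IsSignOrZero (W i j)) × ((W ⊗ transpose W) ≡ᴹ scalarId n (+ k))

IsSignedMonomial : (n : ℕ) → Matrix n → Set
IsSignedMonomial n M =
  (∀ i j → IsSignOrZero (M i j)) ×
  (∀ i → Σ (Fin n) λ j → (M i j ≢ + 0) × (∀ j' → M i j' ≢ + 0 → j' ≡ j)) ×
  (∀ j → Σ (Fin n) λ i → (M i j ≢ + 0) × (∀ i' → M i' j ≢ + 0 → i' ≡ i))

Equivalent : (n : ℕ) → Matrix n → Matrix n → Set
Equivalent n W₁ W₂ =
  Σ (Matrix n) λ P → Σ (Matrix n) λ Q →
    IsSignedMonomial n P × IsSignedMonomial n Q × (W₁ ≡ᴹ (P ⊗ (W₂ ⊗ Q)))

module Submission where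

-- Two rows of a weighing matrix of order 12 and weight 10 have an even number of common nonzero
-- columns, so their zero pairs are equal or disjoint, and the rows and columns can be ordered so
-- that the zeros fill the six diagonal 2 × 2 blocks. Counting modulo 4, two rows with the same
-- zeros agree in exactly one column of every other zero pair. Hence, after permutations and sign
-- changes, the first two rows are
--   0 0 + + + + + + + + + +
--   0 0 + − + − + − + − + −
-- and so are the first two columns. A row by row search leaves 864 such matrices, and an explicit
-- signed relabelling takes each of them to one of five representatives. These are told apart by
-- an invariant built from products of rows, evaluated on the matrix and on its transpose.

open import Defs
open import Data.Empty using (⊥; ⊥-elim)
open import Data.Fin as Fin using (Fin; zero; suc; punchIn; punchOut; combine; remQuot)
open import Data.Fin.Permutation using (Permutation; permutation; _⟨$⟩ʳ_; _⟨$⟩ˡ_; inverseˡ; inverseʳ; flip; _∘ₚ_)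
import Data.Fin.Properties as Fin
open import Data.Integer as ℤ using (ℤ; +_; -[1+_]; _+_; _*_; _-_; -_; ∣_∣)
import Data.Integer.Properties as ℤ
open import Data.Integer.Tactic.RingSolver using (solve-∀)
open import Data.List as List using (List; []; _∷_; length; filter; tabulate; allFin; concatMap; cartesianProductWith)
open import Data.List.Membership.Propositional using (_∈_)
open import Data.List.Membership.Propositional.Properties using (∈-filter⁺; ∈-filter⁻; ∈-allFin; ∈-concatMap⁺; ∈-map⁺; ∈-cartesianProductWith⁺)
open import Data.List.Relation.Binary.Pointwise as Pointwise using (Pointwise; []; _∷_)
open import Data.List.Relation.Unary.All using ([]; _∷_)
open import Data.List.Relation.Unary.AllPairs using ([]; _∷_)
open import Data.List.Relation.Unary.Any as Any using (here; there)
open import Data.List.Relation.Unary.Unique.Propositional using (Unique)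
import Data.List.Relation.Unary.Unique.Propositional.Properties as Unique
open import Data.Nat as ℕ using (ℕ; zero; suc; _/_)
import Data.Nat.Divisibility as ℕ
open import Data.Nat.DivMod using (_mod_)
import Data.Nat.Properties as ℕ
open import Data.Product using (Σ; ∃; _×_; _,_; proj₁; proj₂; uncurry)
open import Data.Product.Properties using (≡-dec)
open import Data.Sum as Sum using (_⊎_; inj₁; inj₂; [_,_]′)
open import Data.Vec as Vec using (Vec; []; _∷_; lookup)
import Data.Vec.Properties as Vec
open import Data.Vec.Functional using (Vector; removeAt)
open import Data.Vec.Relation.Unary.AllPairs using (allPairs?)
open import Data.Vec.Relation.Unary.Unique.Propositional using () renaming (Unique to UniqueVec)
import Data.Vec.Relation.Unary.Unique.Propositional.Properties as UniqueVec
open import Function using (_∘_; id)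
open import Function.Definitions using (Injective)
open import Relation.Binary.PropositionalEquality
open import Relation.Nullary using (¬_; Dec; yes; no; ¬?; contradiction)
open import Relation.Nullary.Decidable using (map′; from-yes; from-no; toWitness; _×-dec_; _⊎-dec_)
open import Algebra.Properties.AbelianGroup ℤ.+-0-abelianGroup using () renaming (∙-cancelˡ to +-cancelˡ; ∙-cancelʳ to +-cancelʳ)
open import Algebra.Properties.Semiring.Sum ℤ.+-*-semiring
  using (sum; sum-syntax; sum-cong-≗; sum-replicate-zero; sum-remove; ∑-distrib-+; ∑-comm; sum-permute; *-distribˡ-sum)
import Algebra.Properties.CommutativeMonoid.Sum ℕ.+-0-commutativeMonoid as ℕSum

open ≡-Reasoning

-- Two rows sharing `s` zeros have 8 + `s` common nonzero columns, so evenness leaves `s` = 0 or `s`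
-- = 2. The hypothesis speaks of rows only: that each column has exactly two zeros comes from
-- excluding three rows with the same zeros and then counting. The shape of the first two columns
-- comes from the same fact as that of the first two rows. Two rows with the same zeros meet the
-- zero pair of any other row pair in a 2 × 2 block of signs, and agreeing in exactly one of its
-- columns means that the four signs multiply to -1, a condition that transposition preserves. The
-- normal form fixes the signs of rows and columns and the order within the pairs; the order of the
-- six pairs and the choice of the first row and column remain free, so one class appears many times
-- among the 864 matrices.

-- Sums over a finite index, and congruences between them

sumFin≡sum : ∀ n (f : Vector ℤ n) → sumFin n f ≡ sum f
sumFin≡sum zero    f = refl
sumFin≡sum (suc n) f = cong (_+_ (f zero)) (sumFin≡sum n (f ∘ suc))

sum-zero : ∀ {n} {f : Vector ℤ n} → (∀ i → f i ≡ + 0) → sum f ≡ + 0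
sum-zero {n} f≡0 = trans (sum-cong-≗ f≡0) (sum-replicate-zero n)

sum-single : ∀ {n} (f : Vector ℤ n) c → (∀ j → j ≢ c → f j ≡ + 0) → sum f ≡ f c
sum-single {suc n} f c off = begin
  sum f                       ≡⟨ sum-remove {i = c} f ⟩
  f c + sum (removeAt f c)    ≡⟨ cong (_+_ (f c)) (sum-zero λ j → off _ (Fin.punchInᵢ≢i c j)) ⟩
  f c + + 0                   ≡⟨ ℤ.+-identityʳ _ ⟩
  f c                         ∎

sum-pair : ∀ {n} (f : Vector ℤ n) {c d} → c ≢ d →
           (∀ j → j ≢ c → j ≢ d → f j ≡ + 0) → sum f ≡ f c + f d
sum-pair {suc zero}    f {zero} {zero} c≢d off = contradiction refl c≢d
sum-pair {suc (suc n)} f {c} {d} c≢d off = begin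
  sum f                                  ≡⟨ sum-remove {i = c} f ⟩
  f c + sum (removeAt f c)               ≡⟨ cong (_+_ (f c)) (sum-single (removeAt f c) (punchOut c≢d) off′) ⟩
  f c + f (punchIn c (punchOut c≢d))     ≡⟨ cong (λ j → f c + f j) (Fin.punchIn-punchOut c≢d) ⟩
  f c + f d                              ∎
  where
  off′ : ∀ j → j ≢ punchOut c≢d → f (punchIn c j) ≡ + 0
  off′ j j≢ = off _ (Fin.punchInᵢ≢i c j) λ eq →
    j≢ (Fin.punchIn-injective c _ _ (trans eq (sym (Fin.punchIn-punchOut c≢d))))

-- Congruence modulo `m` is carried by explicit quotients, so that a contradiction can be read off
-- as a divisibility between two numerals.
sum-mod : ∀ {n} (m : ℤ) {f g : Vector ℤ n} → (∀ i → ∃ λ q → f i ≡ g i + m * q) →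
          ∃ λ q → sum f ≡ sum g + m * q
sum-mod m {f} {g} h = sum q , (begin
  sum f                          ≡⟨ sum-cong-≗ (λ i → proj₂ (h i)) ⟩
  sum (λ i → g i + m * q i)      ≡⟨ ∑-distrib-+ g (λ i → m * q i) ⟩
  sum g + sum (λ i → m * q i)    ≡⟨ cong (_+_ (sum g)) (*-distribˡ-sum m q) ⟨
  sum g + m * sum q              ∎)
  where
  q = λ i → proj₁ (h i)

divides-abs : ∀ m q {z} → + m * q ≡ z → m ℕ.∣ ∣ z ∣
divides-abs m q refl = ℕ.divides ∣ q ∣ (trans (ℤ.abs-* (+ m) q) (ℕ.*-comm m ∣ q ∣))

-- The shape in which the counts modulo 2 and 4 end: a known total `y`, a part that is 0 modulo `m`,
-- and the contribution `z` of the two zero columns of a row.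
remainder-eq : ∀ m q z {x y} → x ≡ y → x ≡ + 0 + m * q + z → m * q ≡ y - z
remainder-eq m q z {x} refl eq = trans (lemma (m * q) z) (cong (λ w → w - z) (sym eq))
  where
  lemma : ∀ p z → p ≡ + 0 + p + z - z
  lemma = solve-∀

-- Arithmetic of signs

IsSign : ℤ → Set
IsSign x = x ≡ + 1 ⊎ x ≡ -[1+ 0 ]

sign-square : ∀ {x} → IsSign x → x * x ≡ + 1
sign-square (inj₁ refl) = refl
sign-square (inj₂ refl) = refl

sign≢0 : ∀ {x} → IsSign x → x ≢ + 0
sign≢0 (inj₁ refl) ()
sign≢0 (inj₂ refl) ()

sign-cancel : ∀ {x} y → IsSign x → x * x * y ≡ y
sign-cancel y sx = trans (cong (λ u → u * y) (sign-square sx)) (ℤ.*-identityˡ y)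

sign-* : ∀ {x y} → IsSign x → IsSign y → IsSign (x * y)
sign-* (inj₁ refl) (inj₁ refl) = inj₁ refl
sign-* (inj₁ refl) (inj₂ refl) = inj₂ refl
sign-* (inj₂ refl) (inj₁ refl) = inj₂ refl
sign-* (inj₂ refl) (inj₂ refl) = inj₁ refl

signed : ∀ {x} → IsSignOrZero x → x ≢ + 0 → IsSign x
signed (inj₁ x≡1)         _   = inj₁ x≡1
signed (inj₂ (inj₁ x≡-1)) _   = inj₂ x≡-1
signed (inj₂ (inj₂ x≡0))  x≢0 = contradiction x≡0 x≢0

square-nonzero : ∀ {x} → IsSignOrZero x → x ≢ + 0 → x * x ≡ + 1
square-nonzero s x≢0 = sign-square (signed s x≢0)

-- Zeros of sign vectors

SignVector : ∀ {n} → Vector ℤ n → Set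
SignVector t = ∀ c → IsSignOrZero (t c)

zeros : ∀ {n} → Vector ℤ n → List (Fin n)
zeros t = filter (λ c → t c ℤ.≟ + 0) (allFin _)

-- Each column contributes 1 either to the length or to the sum of squares. Applied to a row it
-- yields the two zeros; applied to a column it ties the number of zeros to the weight of that
-- column.
length-zeros : ∀ {n} (t : Vector ℤ n) → SignVector t →
               + length (zeros t) + (∑[ c < n ] (t c * t c)) ≡ + n
length-zeros {n} t s = go n id
  where
  zero? = λ c → t c ℤ.≟ + 0

  regroup : ∀ x y z → x + (y + z) ≡ y + (x + z)
  regroup = solve-∀

  -- The induction runs over an arbitrary enumeration `f`, because the tail of `allFin` is a
  -- `tabulate` but no longer an `allFin`.
  go : ∀ k (f : Fin k → Fin n) →
       + length (filter zero? (tabulate f)) + (∑[ c < k ] (t (f c) * t (f c))) ≡ + k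
  go zero    f = refl
  go (suc k) f with t (f zero) ℤ.≟ + 0
  ... | yes p = begin
    + suc l + (t (f zero) * t (f zero) + S)  ≡⟨ cong (λ x → + suc l + (x * x + S)) p ⟩
    + suc l + (+ 0 + S)                      ≡⟨ cong (_+_ (+ suc l)) (ℤ.+-identityˡ S) ⟩
    + 1 + + l + S                            ≡⟨ ℤ.+-assoc (+ 1) (+ l) S ⟩
    + 1 + (+ l + S)                          ≡⟨ cong (_+_ (+ 1)) (go k (f ∘ suc)) ⟩
    + suc k                                  ∎
    where
    l = length (filter zero? (tabulate (f ∘ suc)))
    S = ∑[ c < k ] (t (f (suc c)) * t (f (suc c)))
  ... | no p = begin
    + l + (t (f zero) * t (f zero) + S)      ≡⟨ cong (λ x → + l + (x + S)) (square-nonzero (s _) p) ⟩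
    + l + (+ 1 + S)                          ≡⟨ regroup (+ l) (+ 1) S ⟩
    + 1 + (+ l + S)                          ≡⟨ cong (_+_ (+ 1)) (go k (f ∘ suc)) ⟩
    + suc k                                  ∎
    where
    l = length (filter zero? (tabulate (f ∘ suc)))
    S = ∑[ c < k ] (t (f (suc c)) * t (f (suc c)))

record TwoZeros {n} (t : Vector ℤ n) : Set where
  field
    fst snd  : Fin n
    distinct : fst ≢ snd
    fst-zero : t fst ≡ + 0
    snd-zero : t snd ≡ + 0
    only     : ∀ {c} → t c ≡ + 0 → c ≡ fst ⊎ c ≡ snd

zeros-unique : ∀ {n} (t : Vector ℤ n) → Unique (zeros t)
zeros-unique t = Unique.filter⁺ (λ c → t c ℤ.≟ + 0) (Unique.allFin⁺ _)

∈-zeros⁺ : ∀ {n} (t : Vector ℤ n) {c} → t c ≡ + 0 → c ∈ zeros t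
∈-zeros⁺ t = ∈-filter⁺ (λ c → t c ℤ.≟ + 0) (∈-allFin _)

∈-zeros⁻ : ∀ {n} (t : Vector ℤ n) {c} → c ∈ zeros t → t c ≡ + 0
∈-zeros⁻ t c∈ = proj₂ (∈-filter⁻ (λ c → t c ℤ.≟ + 0) {xs = allFin _} c∈)

twoZeros : ∀ {n} (t : Vector ℤ n) → length (zeros t) ≡ 2 → TwoZeros t
twoZeros t len = go (zeros t) len (zeros-unique t) (∈-zeros⁺ t) (∈-zeros⁻ t)
  where
  go : ∀ zs → length zs ≡ 2 → Unique zs → (∀ {c} → t c ≡ + 0 → c ∈ zs) →
       (∀ {c} → c ∈ zs → t c ≡ + 0) → TwoZeros t
  go (c ∷ d ∷ []) _ ((c≢d ∷ []) ∷ _) to from = record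
    { fst = c ; snd = d ; distinct = c≢d
    ; fst-zero = from (here refl) ; snd-zero = from (there (here refl))
    ; only = λ z → [here-or-there] (to z)
    }
    where
    [here-or-there] : ∀ {e} → e ∈ c ∷ d ∷ [] → e ≡ c ⊎ e ≡ d
    [here-or-there] (here p)         = inj₁ p
    [here-or-there] (there (here p)) = inj₂ p

-- The two zeros of t are split off a sum; on all other columns t² is 1.
sum-split : ∀ {n} (f : Vector ℤ n) {t : Vector ℤ n} → SignVector t → (z : TwoZeros t) →
            let open TwoZeros z in
            sum f ≡ sum (λ c → f c * (t c * t c)) + (f fst + f snd)
sum-split f {t} s z = begin
  sum f                                                  ≡⟨ sum-cong-≗ (λ c → split (f c) (t c * t c)) ⟩
  sum (λ c → f c * (t c * t c) + f c * (+ 1 - t c * t c)) ≡⟨ ∑-distrib-+ (λ c → f c * (t c * t c)) g ⟩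
  sum (λ c → f c * (t c * t c)) + sum g                  ≡⟨ cong (_+_ (sum (λ c → f c * (t c * t c)))) rest ⟩
  sum (λ c → f c * (t c * t c)) + (f fst + f snd)        ∎
  where
  open TwoZeros z
  g = λ c → f c * (+ 1 - t c * t c)

  split : ∀ x y → x ≡ x * y + x * (+ 1 - y)
  split = solve-∀

  g-zero : ∀ {c} → t c ≡ + 0 → g c ≡ f c
  g-zero {c} tc≡0 = trans (cong (λ x → f c * (+ 1 - x * x)) tc≡0) (ℤ.*-identityʳ (f c))

  rest : sum g ≡ f fst + f snd
  rest = trans
    (sum-pair g distinct λ c c≢fst c≢snd →
      trans (cong (λ x → f c * (+ 1 - x)) (square-nonzero (s c) ([ c≢fst , c≢snd ]′ ∘ only)))
            (ℤ.*-zeroʳ (f c)))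
    (cong₂ _+_ (g-zero fst-zero) (g-zero snd-zero))

-- The rows a and b have an even number of common nonzero columns, since ab is ±1 there.
zeros-together : ∀ {a b : Vector ℤ 12} → SignVector a → SignVector b → (z : TwoZeros a) →
  sum (λ c → a c * b c) ≡ + 0 → sum (λ c → b c * b c) ≡ + 10 →
  let open TwoZeros z in (b fst ≡ + 0 → b snd ≡ + 0) × (b snd ≡ + 0 → b fst ≡ + 0)
zeros-together {a} {b} sa sb z ab≡0 bb≡10 = decide {q = proj₁ even} (sb fst) (sb snd) eq
  where
  open TwoZeros z

  parity : ∀ {x y} → IsSignOrZero x → IsSignOrZero y →
           ∃ λ q → y * y * (x * x) ≡ x * y + + 2 * q
  parity (inj₁ refl)        (inj₁ refl)        = + 0 , refl
  parity (inj₁ refl)        (inj₂ (inj₁ refl)) = + 1 , refl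
  parity (inj₁ refl)        (inj₂ (inj₂ refl)) = + 0 , refl
  parity (inj₂ (inj₁ refl)) (inj₁ refl)        = + 1 , refl
  parity (inj₂ (inj₁ refl)) (inj₂ (inj₁ refl)) = + 0 , refl
  parity (inj₂ (inj₁ refl)) (inj₂ (inj₂ refl)) = + 0 , refl
  parity (inj₂ (inj₂ refl)) (inj₁ refl)        = + 0 , refl
  parity (inj₂ (inj₂ refl)) (inj₂ (inj₁ refl)) = + 0 , refl
  parity (inj₂ (inj₂ refl)) (inj₂ (inj₂ refl)) = + 0 , refl

  even = sum-mod (+ 2) {g = λ c → a c * b c} (λ c → parity (sa c) (sb c))

  rest = b fst * b fst + b snd * b snd

  eq : + 2 * proj₁ even ≡ + 10 - rest
  eq = remainder-eq (+ 2) (proj₁ even) rest bb≡10 (begin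
    sum (λ c → b c * b c)                              ≡⟨ sum-split (λ c → b c * b c) sa z ⟩
    sum (λ c → b c * b c * (a c * a c)) + rest         ≡⟨ cong (λ x → x + rest) (proj₂ even) ⟩
    sum (λ c → a c * b c) + + 2 * proj₁ even + rest    ≡⟨ cong (λ x → x + + 2 * proj₁ even + rest) ab≡0 ⟩
    + 0 + + 2 * proj₁ even + rest                      ∎)

  -- If exactly one of the two columns is a zero of `b`, then `rest` is 1 and 9 of the weight 10
  -- remains.
  odd : ∀ {q} → + 2 * q ≡ + 9 → ⊥
  odd {q} = from-no (2 ℕ.∣? 9) ∘ divides-abs 2 q

  decide : ∀ {x y q} → IsSignOrZero x → IsSignOrZero y → + 2 * q ≡ + 10 - (x * x + y * y) →
           (x ≡ + 0 → y ≡ + 0) × (y ≡ + 0 → x ≡ + 0)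
  decide         (inj₂ (inj₂ refl)) (inj₂ (inj₂ refl)) eq = id , id
  decide {q = q} (inj₂ (inj₂ refl)) (inj₁ refl)        eq = ⊥-elim (odd {q} eq)
  decide {q = q} (inj₂ (inj₂ refl)) (inj₂ (inj₁ refl)) eq = ⊥-elim (odd {q} eq)
  decide {q = q} (inj₁ refl)        (inj₂ (inj₂ refl)) eq = ⊥-elim (odd {q} eq)
  decide {q = q} (inj₂ (inj₁ refl)) (inj₂ (inj₂ refl)) eq = ⊥-elim (odd {q} eq)
  decide (inj₁ refl)        (inj₁ refl)        _ = (λ ()) , (λ ())
  decide (inj₁ refl)        (inj₂ (inj₁ refl)) _ = (λ ()) , (λ ())
  decide (inj₂ (inj₁ refl)) (inj₁ refl)        _ = (λ ()) , (λ ())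
  decide (inj₂ (inj₁ refl)) (inj₂ (inj₁ refl)) _ = (λ ()) , (λ ())

SameZeros : ∀ {n} → Vector ℤ n → Vector ℤ n → Set
SameZeros a b = ∀ c → (a c ≡ + 0 → b c ≡ + 0) × (b c ≡ + 0 → a c ≡ + 0)

-- Two rows with the same zeros take only these five pairs of values in a column, so the congruences
-- modulo 4 reduce to short tables checked by evaluation.
data CommonSupport : ℤ → ℤ → Set where
  both-zero  : CommonSupport (+ 0) (+ 0)
  pos-pos    : CommonSupport (+ 1) (+ 1)
  pos-neg    : CommonSupport (+ 1) -[1+ 0 ]
  neg-pos    : CommonSupport -[1+ 0 ] (+ 1)
  neg-neg    : CommonSupport -[1+ 0 ] -[1+ 0 ]

commonSupport : ∀ {x y} → IsSignOrZero x → IsSignOrZero y →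
                (x ≡ + 0 → y ≡ + 0) × (y ≡ + 0 → x ≡ + 0) → CommonSupport x y
commonSupport (inj₁ refl)        (inj₁ refl)        _ = pos-pos
commonSupport (inj₁ refl)        (inj₂ (inj₁ refl)) _ = pos-neg
commonSupport (inj₂ (inj₁ refl)) (inj₁ refl)        _ = neg-pos
commonSupport (inj₂ (inj₁ refl)) (inj₂ (inj₁ refl)) _ = neg-neg
commonSupport (inj₂ (inj₂ refl)) (inj₂ (inj₂ refl)) _ = both-zero
commonSupport (inj₂ (inj₂ refl)) (inj₁ refl)        h with () ← proj₁ h refl
commonSupport (inj₂ (inj₂ refl)) (inj₂ (inj₁ refl)) h with () ← proj₁ h refl
commonSupport (inj₁ refl)        (inj₂ (inj₂ refl)) h with () ← proj₂ h refl
commonSupport (inj₂ (inj₁ refl)) (inj₂ (inj₂ refl)) h with () ← proj₂ h refl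

-- Summing (a + b)(a + c), a multiple of 4 in every column, gives 10.
no-three-rows : ∀ {a b c : Vector ℤ 12} → SignVector a → SignVector b → SignVector c →
  SameZeros a b → SameZeros a c → sum (λ j → a j * a j) ≡ + 10 →
  sum (λ j → a j * b j) ≡ + 0 → sum (λ j → a j * c j) ≡ + 0 → sum (λ j → b j * c j) ≡ + 0 → ⊥
no-three-rows {a} {b} {c} sa sb sc ab-zeros ac-zeros aa≡10 ab≡0 ac≡0 bc≡0 =
  from-no (4 ℕ.∣? 10) (divides-abs 4 (proj₁ quarter) (sym total))
  where
  multiple : ∀ {x y z} → CommonSupport x y → CommonSupport x z →
             ∃ λ q → x * x + x * y + (x * z + y * z) ≡ + 0 + + 4 * q
  multiple both-zero both-zero = + 0 , refl
  multiple pos-pos pos-pos = + 1 , refl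
  multiple pos-pos pos-neg = + 0 , refl
  multiple pos-neg pos-pos = + 0 , refl
  multiple pos-neg pos-neg = + 0 , refl
  multiple neg-pos neg-pos = + 0 , refl
  multiple neg-pos neg-neg = + 0 , refl
  multiple neg-neg neg-pos = + 0 , refl
  multiple neg-neg neg-neg = + 1 , refl

  quarter = sum-mod (+ 4) {g = λ _ → + 0} λ j →
    multiple (commonSupport (sa j) (sb j) (ab-zeros j)) (commonSupport (sa j) (sc j) (ac-zeros j))

  total : + 10 ≡ + 4 * proj₁ quarter
  total = begin
    + 10 + + 0 + (+ 0 + + 0)
      ≡⟨ cong₂ _+_ (cong₂ _+_ aa≡10 ab≡0) (cong₂ _+_ ac≡0 bc≡0) ⟨
    sum (λ j → a j * a j) + sum (λ j → a j * b j) + (sum (λ j → a j * c j) + sum (λ j → b j * c j))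
      ≡⟨ cong₂ _+_ (∑-distrib-+ (λ j → a j * a j) (λ j → a j * b j)) (∑-distrib-+ (λ j → a j * c j) (λ j → b j * c j)) ⟨
    sum (λ j → a j * a j + a j * b j) + sum (λ j → a j * c j + b j * c j)
      ≡⟨ ∑-distrib-+ (λ j → a j * a j + a j * b j) (λ j → a j * c j + b j * c j) ⟨
    sum (λ j → a j * a j + a j * b j + (a j * c j + b j * c j))
      ≡⟨ proj₂ quarter ⟩
    + 0 + + 4 * proj₁ quarter
      ≡⟨ ℤ.+-identityˡ _ ⟩
    + 4 * proj₁ quarter ∎

-- Modulo 4, (a + b) t equals (a² + a b) t²; summing, the two zero columns of t must
-- contribute 2 to a total of 10.
mixed-on-zeros : ∀ {a b t : Vector ℤ 12} → SignVector a → SignVector b → SignVector t →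
  SameZeros a b → (z : TwoZeros t) → let open TwoZeros z in a fst ≢ + 0 → a snd ≢ + 0 →
  sum (λ j → a j * a j) ≡ + 10 → sum (λ j → a j * b j) ≡ + 0 →
  sum (λ j → a j * t j) ≡ + 0 → sum (λ j → b j * t j) ≡ + 0 →
  a fst * b fst + a snd * b snd ≡ + 0
mixed-on-zeros {a} {b} {t} sa sb st ab-zeros z afst≢0 asnd≢0 aa≡10 ab≡0 at≡0 bt≡0 =
  decide {q = proj₁ quarter} (support fst) (support snd) afst≢0 asnd≢0 eq
  where
  open TwoZeros z
  support = λ j → commonSupport (sa j) (sb j) (ab-zeros j)

  residue : ∀ {x y w} → CommonSupport x y → IsSignOrZero w →
            ∃ λ q → (x * x + x * y) * (w * w) ≡ (x * w + y * w) + + 4 * q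
  residue both-zero (inj₁ refl)        = + 0 , refl
  residue both-zero (inj₂ (inj₁ refl)) = + 0 , refl
  residue both-zero (inj₂ (inj₂ refl)) = + 0 , refl
  residue pos-pos   (inj₁ refl)        = + 0 , refl
  residue pos-pos   (inj₂ (inj₁ refl)) = + 1 , refl
  residue pos-pos   (inj₂ (inj₂ refl)) = + 0 , refl
  residue pos-neg   (inj₁ refl)        = + 0 , refl
  residue pos-neg   (inj₂ (inj₁ refl)) = + 0 , refl
  residue pos-neg   (inj₂ (inj₂ refl)) = + 0 , refl
  residue neg-pos   (inj₁ refl)        = + 0 , refl
  residue neg-pos   (inj₂ (inj₁ refl)) = + 0 , refl
  residue neg-pos   (inj₂ (inj₂ refl)) = + 0 , refl
  residue neg-neg   (inj₁ refl)        = + 1 , refl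
  residue neg-neg   (inj₂ (inj₁ refl)) = + 0 , refl
  residue neg-neg   (inj₂ (inj₂ refl)) = + 0 , refl

  quarter = sum-mod (+ 4) {g = λ j → a j * t j + b j * t j} λ j → residue (support j) (st j)

  f = λ j → a j * a j + a j * b j

  total : sum f ≡ + 10
  total = trans (∑-distrib-+ (λ j → a j * a j) (λ j → a j * b j)) (cong₂ _+_ aa≡10 ab≡0)

  rest = f fst + f snd

  eq : + 4 * proj₁ quarter ≡ + 10 - rest
  eq = remainder-eq (+ 4) (proj₁ quarter) rest total (begin
    sum f
      ≡⟨ sum-split f st z ⟩
    sum (λ j → f j * (t j * t j)) + rest
      ≡⟨ cong (λ x → x + rest) (proj₂ quarter) ⟩
    sum (λ j → a j * t j + b j * t j) + + 4 * proj₁ quarter + rest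
      ≡⟨ cong (λ x → x + + 4 * proj₁ quarter + rest)
              (trans (∑-distrib-+ (λ j → a j * t j) (λ j → b j * t j)) (cong₂ _+_ at≡0 bt≡0)) ⟩
    + 0 + + 4 * proj₁ quarter + rest ∎)

  decide : ∀ {x y v w q} → CommonSupport x y → CommonSupport v w → x ≢ + 0 → v ≢ + 0 →
           + 4 * q ≡ + 10 - (x * x + x * y + (v * v + v * w)) → x * y + v * w ≡ + 0
  decide both-zero _         x≢0 _ _ = contradiction refl x≢0
  decide pos-pos   both-zero _ v≢0 _ = contradiction refl v≢0
  decide pos-neg   both-zero _ v≢0 _ = contradiction refl v≢0
  decide neg-pos   both-zero _ v≢0 _ = contradiction refl v≢0
  decide neg-neg   both-zero _ v≢0 _ = contradiction refl v≢0
  decide pos-pos   pos-neg   _ _ _ = refl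
  decide pos-pos   neg-pos   _ _ _ = refl
  decide neg-neg   pos-neg   _ _ _ = refl
  decide neg-neg   neg-pos   _ _ _ = refl
  decide pos-neg   pos-pos   _ _ _ = refl
  decide pos-neg   neg-neg   _ _ _ = refl
  decide neg-pos   pos-pos   _ _ _ = refl
  decide neg-pos   neg-neg   _ _ _ = refl
  -- Equal signs in both zero columns of `t` leave 10 - 4 = 6, opposite signs in both leave 10 - 0 =
  -- 10. Neither is divisible by 4, whereas the mixed cases above leave 8.
  decide {q = q} pos-pos pos-pos _ _ eq = ⊥-elim (from-no (4 ℕ.∣? 6) (divides-abs 4 q eq))
  decide {q = q} pos-pos neg-neg _ _ eq = ⊥-elim (from-no (4 ℕ.∣? 6) (divides-abs 4 q eq))
  decide {q = q} neg-neg pos-pos _ _ eq = ⊥-elim (from-no (4 ℕ.∣? 6) (divides-abs 4 q eq))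
  decide {q = q} neg-neg neg-neg _ _ eq = ⊥-elim (from-no (4 ℕ.∣? 6) (divides-abs 4 q eq))
  decide {q = q} pos-neg pos-neg _ _ eq = ⊥-elim (from-no (4 ℕ.∣? 10) (divides-abs 4 q eq))
  decide {q = q} pos-neg neg-pos _ _ eq = ⊥-elim (from-no (4 ℕ.∣? 10) (divides-abs 4 q eq))
  decide {q = q} neg-pos pos-neg _ _ eq = ⊥-elim (from-no (4 ℕ.∣? 10) (divides-abs 4 q eq))
  decide {q = q} neg-pos neg-pos _ _ eq = ⊥-elim (from-no (4 ℕ.∣? 10) (divides-abs 4 q eq))

-- Injections and transversals on finite sets

injective⇒surjective : ∀ {n} (f : Fin n → Fin n) → Injective _≡_ _≡_ f → ∀ y → ∃ λ x → f x ≡ y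
injective⇒surjective {suc n} f inj y with Fin.any? (λ x → f x Fin.≟ y)
... | yes found = found
... | no ¬found = contradiction (Fin.injective⇒≤ {f = g} g-injective) (ℕ.<⇒≱ (ℕ.n<1+n n))
  where
  missed : ∀ x → y ≢ f x
  missed x y≡fx = ¬found (x , sym y≡fx)

  g : Fin (suc n) → Fin n
  g x = punchOut (missed x)

  g-injective : Injective _≡_ _≡_ g
  g-injective eq = inj (Fin.punchOut-injective (missed _) (missed _) eq)

injective⇒permutation : ∀ {n} (f : Fin n → Fin n) → Injective _≡_ _≡_ f → Permutation n n
injective⇒permutation f inj = permutation f (proj₁ ∘ sur) (proj₂ ∘ sur) λ x → inj (proj₂ (sur (f x)))
  where
  sur = injective⇒surjective f inj

remQuot-injective : ∀ {m} n → Injective _≡_ _≡_ (remQuot {m} n)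
remQuot-injective {m} n {i} {j} eq =
  trans (sym (Fin.combine-remQuot {m} n i)) (trans (cong (uncurry combine) eq) (Fin.combine-remQuot {m} n j))

nonneg-sum : ∀ {n} (g : Vector ℕ n) → ∃ λ s → sum (+_ ∘ g) ≡ + s
nonneg-sum {zero}  g = 0 , refl
nonneg-sum {suc n} g with s , eq ← nonneg-sum (g ∘ suc) = g zero ℕ.+ s , cong (_+_ (+ g zero)) eq

nonneg-sum-zero : ∀ {n} (g : Vector ℕ n) → sum (+_ ∘ g) ≡ + 0 → ∀ i → g i ≡ 0
nonneg-sum-zero {suc n} g eq i with s , eq′ ← nonneg-sum (g ∘ suc) = go i
  where
  total : g zero ℕ.+ s ≡ 0
  total = ℤ.+-injective (trans (sym (cong (_+_ (+ g zero)) eq′)) eq)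

  go : ∀ i → g i ≡ 0
  go zero    = ℕ.m+n≡0⇒m≡0 (g zero) total
  go (suc i) = nonneg-sum-zero (g ∘ suc) (trans eq′ (cong +_ (ℕ.m+n≡0⇒n≡0 (g zero) total))) i

module _ {n} {_∼_ : Fin n → Fin n → Set} (_∼?_ : ∀ i j → Dec (i ∼ j)) (∼-sym : ∀ {i j} → i ∼ j → j ∼ i)
         (partner : Fin n → Fin n) (∼-class : ∀ i {j} → i ∼ j → j ≡ i ⊎ j ≡ partner i) where

  -- Pigeonhole: `k` classes of at most two elements cannot exhaust `Fin n`. If they did, naming the
  -- class and the side within it would embed `Fin n` into `Fin (k * 2)`.
  fresh : ∀ {k} → k ℕ.* 2 ℕ.< n → (x : Fin k → Fin n) → ∃ λ i → ∀ a → ¬ x a ∼ i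
  fresh {k} k*2<n x with Fin.any? (λ i → Fin.all? (λ a → ¬? (x a ∼? i)))
  ... | yes found = found
  ... | no ¬found = contradiction (Fin.injective⇒≤ {f = code} code-injective) (ℕ.<⇒≱ k*2<n)
    where
    covered : ∀ i → ∃ λ a → x a ∼ i
    covered i with Fin.any? (λ a → x a ∼? i)
    ... | yes hit = hit
    ... | no miss = contradiction (i , λ a xa∼i → miss (a , xa∼i)) ¬found

    side : ∀ {i a} → i ≡ a ⊎ i ≡ partner a → Fin 2
    side (inj₁ _) = zero
    side (inj₂ _) = suc zero

    class : ∀ i → i ≡ x (proj₁ (covered i)) ⊎ i ≡ partner (x (proj₁ (covered i)))
    class i = ∼-class (x (proj₁ (covered i))) (proj₂ (covered i))

    code : Fin n → Fin (k ℕ.* 2)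
    code i = combine (proj₁ (covered i)) (side (class i))

    same-side : ∀ {i j a b} (p : i ≡ a ⊎ i ≡ partner a) (q : j ≡ b ⊎ j ≡ partner b) →
                a ≡ b → side p ≡ side q → i ≡ j
    same-side (inj₁ refl) (inj₁ refl) refl _ = refl
    same-side (inj₂ refl) (inj₂ refl) refl _ = refl

    code-injective : Injective _≡_ _≡_ code
    code-injective {i} {j} eq
      with a≡b , s≡t ← Fin.combine-injective (proj₁ (covered i)) _ (proj₁ (covered j)) _ eq =
      same-side (class i) (class j) (cong x a≡b) s≡t

  -- Greedy choice, each time outside the classes already met. With `n` = 12 it reaches six rows,
  -- which together with their partners are all the rows.
  transversal : ∀ {k} → k ℕ.* 2 ℕ.≤ n → Σ (Fin k → Fin n) λ x → ∀ {a b} → x a ∼ x b → a ≡ b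
  transversal {zero}  _   = (λ ()) , λ { {()} }
  transversal {suc k} k*2<n with transversal {k} (ℕ.<⇒≤ (ℕ.<⇒≤ k*2<n))
  ... | x , x-distinct with fresh (ℕ.<⇒≤ k*2<n) x
  ... | i , i-fresh = y , y-distinct
    where
    y : Fin (suc k) → Fin n
    y zero    = i
    y (suc a) = x a

    y-distinct : ∀ {a b} → y a ∼ y b → a ≡ b
    y-distinct {zero}  {zero}  _ = refl
    y-distinct {zero}  {suc b} r = contradiction (∼-sym r) (i-fresh b)
    y-distinct {suc a} {zero}  r = contradiction r (i-fresh a)
    y-distinct {suc a} {suc b} r = cong suc (x-distinct r)

-- Normal form

Index : Set
Index = Fin 6 × Fin 2

parity-sign : Fin 2 → ℤ
parity-sign zero       = + 1
parity-sign (suc zero) = -[1+ 0 ]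

-- An index is a pair number and a place within the pair. Only the twenty off-diagonal blocks
-- outside the first block row and block column keep free signs.
choice : Index → Index → List ℤ
choice (zero  , _)        (zero  , _)        = + 0 ∷ []
choice (zero  , zero)     (suc l , _)        = + 1 ∷ []
choice (zero  , suc zero) (suc l , t)        = parity-sign t ∷ []
choice (suc k , _)        (zero  , zero)     = + 1 ∷ []
choice (suc k , s)        (zero  , suc zero) = parity-sign s ∷ []
choice (suc k , _)        (suc l , _) with k Fin.≟ l
... | yes _ = + 0 ∷ []
... | no  _ = + 1 ∷ -[1+ 0 ] ∷ []

index : Fin 12 → Index
index = remQuot 2

record NormalForm (W : Matrix 12) : Set where
  field
    row column           : Fin 12 → Fin 12
    row-injective        : Injective _≡_ _≡_ row
    column-injective     : Injective _≡_ _≡_ column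
    row-sign column-sign : Fin 12 → ℤ
    row-sign-sign        : ∀ i → IsSign (row-sign i)
    column-sign-sign     : ∀ j → IsSign (column-sign j)

  entry : Matrix 12
  entry i j = row-sign i * column-sign j * W (row i) (column j)

  field
    entry-choice : ∀ i j → entry i j ∈ choice (index i) (index j)
    orthogonal   : ∀ i j → i ≢ j → sum (λ c → entry i c * entry j c) ≡ + 0

-- Reduction of a weighing matrix to normal form

module Normalise {W : Matrix 12} (weighing : IsWeighing 12 10 W) where

  entries : ∀ i → SignVector (W i)
  entries = proj₁ weighing

  gram : ∀ i j → sum (λ c → W i c * W j c) ≡ scalarId 12 (+ 10) i j
  gram i j = trans (sym (sumFin≡sum 12 (λ c → W i c * W j c))) (proj₂ weighing i j)

  row-norm : ∀ i → sum (λ c → W i c * W i c) ≡ + 10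
  row-norm i with gram i i
  ... | eq with i Fin.≟ i
  ... | yes _  = eq
  ... | no i≢i = contradiction refl i≢i

  row-orthogonal : ∀ {i j} → i ≢ j → sum (λ c → W i c * W j c) ≡ + 0
  row-orthogonal {i} {j} i≢j with gram i j
  ... | eq with i Fin.≟ j
  ... | yes i≡j = contradiction i≡j i≢j
  ... | no _    = eq

  abstract
    rowZeros : ∀ i → TwoZeros (W i)
    rowZeros i = twoZeros (W i) (ℤ.+-injective (+-cancelʳ (+ 10) _ (+ 2) count))
      where
      count : + length (zeros (W i)) + + 10 ≡ + 12
      count = trans (cong (_+_ (+ length (zeros (W i)))) (sym (row-norm i))) (length-zeros (W i) (entries i))

  open module RowZeros i = TwoZeros (rowZeros i) using ()
    renaming (fst to z₀; snd to z₁; distinct to z₀≢z₁; fst-zero to z₀-zero; snd-zero to z₁-zero; only to only-z)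

  together : ∀ i j → (W j (z₀ i) ≡ + 0 → W j (z₁ i) ≡ + 0) × (W j (z₁ i) ≡ + 0 → W j (z₀ i) ≡ + 0)
  together i j with i Fin.≟ j
  ... | yes refl = (λ _ → z₁-zero i) , (λ _ → z₀-zero i)
  ... | no i≢j   = zeros-together (entries i) (entries j) (rowZeros i) (row-orthogonal i≢j) (row-norm j)

  infix 4 _∼_

  -- Having the same zero pair, tested at a single column: `together` supplies the other one. In
  -- this form the class of `i` is literally the zero set of the column `z₀ i`.
  _∼_ : Fin 12 → Fin 12 → Set
  i ∼ j = W j (z₀ i) ≡ + 0

  _∼?_ : ∀ i j → Dec (i ∼ j)
  i ∼? j = W j (z₀ i) ℤ.≟ + 0

  common-zero : ∀ {i j} c → W i c ≡ + 0 → W j c ≡ + 0 → i ∼ j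
  common-zero {i} {j} c ic jc with only-z i ic
  ... | inj₁ refl = jc
  ... | inj₂ refl = proj₂ (together i j) jc

  ∼-refl : ∀ {i} → i ∼ i
  ∼-refl {i} = z₀-zero i

  ∼-sym : ∀ {i j} → i ∼ j → j ∼ i
  ∼-sym {i} i∼j = common-zero (z₀ i) i∼j (z₀-zero i)

  ∼-zero : ∀ {i j c} → i ∼ j → W i c ≡ + 0 → W j c ≡ + 0
  ∼-zero {i} {j} i∼j ic with only-z i ic
  ... | inj₁ refl = i∼j
  ... | inj₂ refl = proj₁ (together i j) i∼j

  ∼-trans : ∀ {i j k} → i ∼ j → j ∼ k → i ∼ k
  ∼-trans i∼j j∼k = ∼-zero j∼k i∼j

  ∼-sameZeros : ∀ {i j} → i ∼ j → SameZeros (W i) (W j)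
  ∼-sameZeros i∼j c = ∼-zero i∼j , ∼-zero (∼-sym i∼j)

  column-entries : ∀ c → SignVector (transpose W c)
  column-entries c i = entries i c

  abstract
    column-zeros≤2 : ∀ c → length (zeros (transpose W c)) ℕ.≤ 2
    column-zeros≤2 c = go (zeros (transpose W c)) (zeros-unique (transpose W c)) (∈-zeros⁻ (transpose W c))
      where
      go : ∀ zs → Unique zs → (∀ {i} → i ∈ zs → W i c ≡ + 0) → length zs ℕ.≤ 2
      go []           _ _ = ℕ.z≤n
      go (_ ∷ [])     _ _ = ℕ.s≤s ℕ.z≤n
      go (_ ∷ _ ∷ []) _ _ = ℕ.s≤s (ℕ.s≤s ℕ.z≤n)
      go (i ∷ j ∷ k ∷ _) ((i≢j ∷ i≢k ∷ _) ∷ (j≢k ∷ _) ∷ _) zero-at = ⊥-elim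
        (no-three-rows (entries i) (entries j) (entries k)
          (∼-sameZeros (common-zero c (zero-at (here refl)) (zero-at (there (here refl)))))
          (∼-sameZeros (common-zero c (zero-at (here refl)) (zero-at (there (there (here refl))))))
          (row-norm i) (row-orthogonal i≢j) (row-orthogonal i≢k) (row-orthogonal j≢k))

  -- No column has more than two zeros, and the rows account for 24 zeros in 12 columns.
  abstract
    column-zeros≡2 : ∀ c → length (zeros (transpose W c)) ≡ 2
    column-zeros≡2 c = ℕ.≤-antisym (column-zeros≤2 c) (ℕ.m∸n≡0⇒m≤n (nonneg-sum-zero gap gap-total c))
      where
      l : Vector ℕ 12
      l c = length (zeros (transpose W c))

      -- Truncated subtraction loses nothing, since `column-zeros≤2` bounds `l c`; natural numbers
      -- with sum 0 must all vanish.
      gap : Vector ℕ 12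
      gap c = 2 ℕ.∸ l c

      weight : Vector ℤ 12
      weight c = ∑[ i < 12 ] (W i c * W i c)

      balance : ∀ c → + gap c + + 10 ≡ weight c
      balance c = +-cancelˡ (+ l c) (+ gap c + + 10) (weight c) (begin
        + l c + (+ gap c + + 10)    ≡⟨ ℤ.+-assoc (+ l c) (+ gap c) (+ 10) ⟨
        + (l c ℕ.+ gap c) + + 10    ≡⟨ cong (λ n → + n + + 10) (ℕ.m+[n∸m]≡n (column-zeros≤2 c)) ⟩
        + 12                        ≡⟨ length-zeros (transpose W c) (column-entries c) ⟨
        + l c + weight c            ∎)

      gap-total : sum (+_ ∘ gap) ≡ + 0
      gap-total = +-cancelʳ (+ 120) (sum (+_ ∘ gap)) (+ 0) (begin
        sum (+_ ∘ gap) + sum {12} (λ _ → + 10)   ≡⟨ ∑-distrib-+ (+_ ∘ gap) (λ _ → + 10) ⟨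
        sum (λ c → + gap c + + 10)               ≡⟨ sum-cong-≗ balance ⟩
        sum weight                               ≡⟨ ∑-comm (λ c i → W i c * W i c) ⟩
        sum (λ i → sum (λ c → W i c * W i c))    ≡⟨ sum-cong-≗ row-norm ⟩
        + 120                                    ∎)

  abstract
    -- The column `z₀ i` has exactly two zeros. One lies in row `i`, and the row of the other is the
    -- partner.
    partner-exists : ∀ i → ∃ λ p → p ≢ i × i ∼ p × (∀ {j} → i ∼ j → j ≡ i ⊎ j ≡ p)
    partner-exists i = other (z₀-zero i) (twoZeros (transpose W (z₀ i)) (column-zeros≡2 (z₀ i)))
      where
      other : ∀ {c} → W i c ≡ + 0 → TwoZeros (transpose W c) →
              ∃ λ p → p ≢ i × W p c ≡ + 0 × (∀ {j} → W j c ≡ + 0 → j ≡ i ⊎ j ≡ p)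
      other ic column with TwoZeros.only column ic
      ... | inj₁ i≡fst = snd , (λ snd≡i → distinct (trans (sym i≡fst) (sym snd≡i))) , snd-zero
                       , Sum.map₁ (λ j≡fst → trans j≡fst (sym i≡fst)) ∘ only
        where open TwoZeros column
      ... | inj₂ i≡snd = fst , (λ fst≡i → distinct (trans fst≡i i≡snd)) , fst-zero
                       , Sum.swap ∘ Sum.map₂ (λ j≡snd → trans j≡snd (sym i≡snd)) ∘ only
        where open TwoZeros column

  partner : Fin 12 → Fin 12
  partner i = proj₁ (partner-exists i)

  partner≢ : ∀ i → partner i ≢ i
  partner≢ i = proj₁ (proj₂ (partner-exists i))

  ∼-partner : ∀ i → i ∼ partner i
  ∼-partner i = proj₁ (proj₂ (proj₂ (partner-exists i)))

  ∼-class : ∀ i {j} → i ∼ j → j ≡ i ⊎ j ≡ partner i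
  ∼-class i = proj₂ (proj₂ (proj₂ (partner-exists i)))

  abstract
    class-rows : Σ (Fin 6 → Fin 12) λ x → ∀ {a b} → x a ∼ x b → a ≡ b
    class-rows = transversal _∼?_ ∼-sym partner ∼-class ℕ.≤-refl

  x : Fin 6 → Fin 12
  x = proj₁ class-rows

  x-distinct : ∀ {a b} → x a ∼ x b → a ≡ b
  x-distinct = proj₂ class-rows

  -- The pair `a`, `b` ordered by the sign of `n`: kept for plus (and, as a default, for 0),
  -- exchanged for minus.
  pick : ∀ {A : Set} → ℤ → A → A → Fin 2 → A
  pick (+ _)    a b zero       = a
  pick (+ _)    a b (suc zero) = b
  pick -[1+ _ ] a b zero       = b
  pick -[1+ _ ] a b (suc zero) = a

  pick-all : ∀ {A : Set} (P : A → Set) n {a b} → P a → P b → ∀ s → P (pick n a b s)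
  pick-all P (+ _)    pa pb zero       = pa
  pick-all P (+ _)    pa pb (suc zero) = pb
  pick-all P -[1+ _ ] pa pb zero       = pb
  pick-all P -[1+ _ ] pa pb (suc zero) = pa

  pick-injective : ∀ {A : Set} n {a b : A} → a ≢ b → Injective _≡_ _≡_ (pick n a b)
  pick-injective _        a≢b {zero}     {zero}     _  = refl
  pick-injective _        a≢b {suc zero} {suc zero} _  = refl
  pick-injective (+ _)    a≢b {zero}     {suc zero} eq = contradiction eq a≢b
  pick-injective (+ _)    a≢b {suc zero} {zero}     eq = contradiction (sym eq) a≢b
  pick-injective -[1+ _ ] a≢b {zero}     {suc zero} eq = contradiction (sym eq) a≢b
  pick-injective -[1+ _ ] a≢b {suc zero} {zero}     eq = contradiction eq a≢b

  -- When `F` takes opposite signs on a pair, ordering the pair by its own sign puts the positive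
  -- member first. This produces the alternating second row and second column of the normal form.
  pick-sign : ∀ {A : Set} (F : A → ℤ) {a b} → IsSign (F a) → F a + F b ≡ + 0 →
              ∀ s → F (pick (F a) a b s) ≡ parity-sign s
  pick-sign F {a} {b} sa opposite s = go sa s
    where
    Fb : F b ≡ - F a
    Fb = begin
      F b                  ≡⟨ lemma (F a) (F b) ⟩
      F a + F b - F a      ≡⟨ cong (λ y → y - F a) opposite ⟩
      + 0 - F a            ≡⟨ ℤ.+-identityˡ _ ⟩
      - F a                ∎
      where
      lemma : ∀ u v → v ≡ u + v - u
      lemma = solve-∀

    go : IsSign (F a) → ∀ s → F (pick (F a) a b s) ≡ parity-sign s
    go (inj₁ p) zero       = trans (cong (λ n → F (pick n a b zero)) p) p
    go (inj₁ p) (suc zero) = trans (cong (λ n → F (pick n a b (suc zero))) p) (trans Fb (cong -_ p))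
    go (inj₂ p) zero       = trans (cong (λ n → F (pick n a b zero)) p) (trans Fb (cong -_ p))
    go (inj₂ p) (suc zero) = trans (cong (λ n → F (pick n a b (suc zero))) p) p

  r₀ r₁ c₀ c₁ : Fin 12
  r₀ = x zero
  r₁ = partner (x zero)
  c₀ = z₀ (x zero)
  c₁ = z₁ (x zero)

  column-product row-product : Fin 12 → ℤ
  column-product c = W r₀ c * W r₁ c
  row-product    r = W r c₀ * W r c₁

  -- The products deciding the order within a pair involve only the rows, respectively columns, of
  -- pair zero, and do not depend on their order. So pair zero may be ordered arbitrarily, and rows
  -- and columns are ordered without reference to each other.
  ρ κ : Fin 6 → Fin 2 → Fin 12
  ρ zero    = pick (+ 1) (x zero) (partner (x zero))
  ρ (suc k) = pick (row-product (x (suc k))) (x (suc k)) (partner (x (suc k)))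
  κ zero    = pick (+ 1) (z₀ (x zero)) (z₁ (x zero))
  κ (suc l) = pick (column-product (z₀ (x (suc l)))) (z₀ (x (suc l))) (z₁ (x (suc l)))

  x∼ρ : ∀ k s → x k ∼ ρ k s
  x∼ρ zero    = pick-all (x zero ∼_) (+ 1) ∼-refl (∼-partner _)
  x∼ρ (suc k) = pick-all (x (suc k) ∼_) (row-product (x (suc k))) ∼-refl (∼-partner _)

  κ-zero : ∀ l t → W (x l) (κ l t) ≡ + 0
  κ-zero zero    = pick-all (λ c → W (x zero) c ≡ + 0) (+ 1) (z₀-zero _) (z₁-zero _)
  κ-zero (suc l) = pick-all (λ c → W (x (suc l)) c ≡ + 0) (column-product (z₀ (x (suc l)))) (z₀-zero _) (z₁-zero _)

  ρ-injective : ∀ k l {s t} → ρ k s ≡ ρ l t → (k , s) ≡ (l , t)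
  ρ-injective k l {s} {t} eq
    with refl ← x-distinct {k} {l} (∼-trans (x∼ρ k s) (subst (_∼ x l) (sym eq) (∼-sym (x∼ρ l t)))) =
    cong (k ,_) (same k eq)
    where
    same : ∀ k {s t} → ρ k s ≡ ρ k t → s ≡ t
    same zero    = pick-injective (+ 1) (partner≢ _ ∘ sym)
    same (suc k) = pick-injective (row-product (x (suc k))) (partner≢ _ ∘ sym)

  κ-injective : ∀ k l {s t} → κ k s ≡ κ l t → (k , s) ≡ (l , t)
  κ-injective k l {s} {t} eq
    with refl ← x-distinct {k} {l} (common-zero (κ k s) (κ-zero k s)
           (subst (λ c → W (x l) c ≡ + 0) (sym eq) (κ-zero l t))) =
    cong (k ,_) (same k eq)
    where
    same : ∀ k {s t} → κ k s ≡ κ k t → s ≡ t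
    same zero    = pick-injective (+ 1) (z₀≢z₁ _)
    same (suc k) = pick-injective (column-product (z₀ (x (suc k)))) (z₀≢z₁ _)

  V : Index → Index → ℤ
  V (k , s) (l , t) = W (ρ k s) (κ l t)

  V-zero : ∀ k {s t} → V (k , s) (k , t) ≡ + 0
  V-zero k {s} {t} = ∼-zero (x∼ρ k s) (κ-zero k t)

  nonzero : ∀ {i j c} → ¬ i ∼ j → W i c ≡ + 0 → IsSign (W j c)
  nonzero {i} {j} {c} i≁j ic = signed (entries j c) λ jc → i≁j (common-zero c ic jc)

  V-sign : ∀ {k l} s t → k ≢ l → IsSign (V (k , s) (l , t))
  V-sign {k} {l} s t k≢l =
    nonzero (λ l∼ → k≢l (sym (x-distinct (∼-trans l∼ (∼-sym (x∼ρ k s)))))) (κ-zero l t)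

  opposite : ∀ i j → ¬ i ∼ j →
             W j (z₀ i) * W (partner j) (z₀ i) + W j (z₁ i) * W (partner j) (z₁ i) ≡ + 0
  opposite i j i≁j = mixed-on-zeros (entries j) (entries (partner j)) (entries i)
    (∼-sameZeros (∼-partner j)) (rowZeros i)
    (sign≢0 (nonzero i≁j (z₀-zero i))) (sign≢0 (nonzero i≁j (z₁-zero i)))
    (row-norm j) (row-orthogonal (partner≢ j ∘ sym))
    (row-orthogonal λ { refl → i≁j ∼-refl }) (row-orthogonal λ { refl → i≁j (∼-sym (∼-partner j)) })

  x-apart : ∀ {k l} → k ≢ l → ¬ x k ∼ x l
  x-apart k≢l = k≢l ∘ x-distinct

  partner-apart : ∀ {i j} → ¬ i ∼ j → ¬ i ∼ partner j
  partner-apart {j = j} i≁j i∼p = i≁j (∼-trans i∼p (∼-sym (∼-partner j)))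

  column-products : ∀ l t → V (zero , zero) (suc l , t) * V (zero , suc zero) (suc l , t) ≡ parity-sign t
  column-products l = pick-sign column-product
    (sign-* (nonzero apart (z₀-zero _)) (nonzero (partner-apart apart) (z₀-zero _)))
    (opposite (x (suc l)) (x zero) apart)
    where
    apart : ¬ x (suc l) ∼ x zero
    apart = x-apart λ ()

  row-products : ∀ k s → V (suc k , s) (zero , zero) * V (suc k , s) (zero , suc zero) ≡ parity-sign s
  row-products k = pick-sign row-product
    (sign-* s₁ s₃)
    (swap s₁ (nonzero (partner-apart apart) (z₀-zero _)) s₃ (opposite (x zero) (x (suc k)) apart))
    where
    apart : ¬ x zero ∼ x (suc k)
    apart = x-apart λ ()

    s₁ = nonzero apart (z₀-zero _)
    s₃ = nonzero apart (z₁-zero _)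

    -- Each equation says that the product of the four signs is -1. Multiplying the first by `b * c`
    -- and cancelling squares passes from products down the columns of a block to products along its
    -- rows.
    swap : ∀ {a b c d} → IsSign a → IsSign b → IsSign c →
           a * b + c * d ≡ + 0 → a * c + b * d ≡ + 0
    swap {a} {b} {c} {d} sa sb sc eq = begin
      a * c + b * d                                 ≡⟨ cong₂ _+_ (sign-cancel (a * c) sb) (sign-cancel (b * d) sc) ⟨
      b * b * (a * c) + c * c * (b * d)             ≡⟨ lemma a b c d ⟩
      b * c * (a * b + c * d)                       ≡⟨ cong (_*_ (b * c)) eq ⟩
      b * c * + 0                                   ≡⟨ ℤ.*-zeroʳ (b * c) ⟩
      + 0                                           ∎
      where
      lemma : ∀ a b c d → b * b * (a * c) + c * c * (b * d) ≡ b * c * (a * b + c * d)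
      lemma = solve-∀

  -- A column is multiplied by its own entry in the first row. That row becomes all ones on its
  -- support, and the second row becomes the product of the first two, which `κ` has made alternate;
  -- rows are treated likewise. Pair zero has zeros there, so it keeps the sign 1.
  ε δ : Index → ℤ
  ε (zero  , _) = + 1
  ε (suc k , s) = V (suc k , s) (zero , zero)
  δ (zero  , _) = + 1
  δ (suc l , t) = V (zero , zero) (suc l , t)

  ε-sign : ∀ i → IsSign (ε i)
  ε-sign (zero  , _) = inj₁ refl
  ε-sign (suc k , s) = V-sign {suc k} {zero} s zero λ ()

  δ-sign : ∀ j → IsSign (δ j)
  δ-sign (zero  , _) = inj₁ refl
  δ-sign (suc l , t) = V-sign {zero} {suc l} zero t λ ()

  drop-one : ∀ y v → + 1 * y * v ≡ y * v
  drop-one y v = cong (λ u → u * v) (ℤ.*-identityˡ y)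

  drop-one′ : ∀ y v → y * + 1 * v ≡ y * v
  drop-one′ y v = cong (λ u → u * v) (ℤ.*-identityʳ y)

  normalised : ∀ i j → ε i * δ j * V i j ∈ choice i j
  normalised (zero , s) (zero , t) = here (trans (ℤ.*-identityˡ _) (V-zero zero {s} {t}))
  normalised (zero , zero) (suc l , t) =
    here (trans (drop-one (δ (suc l , t)) (δ (suc l , t))) (sign-square (δ-sign (suc l , t))))
  normalised (zero , suc zero) (suc l , t) =
    here (trans (drop-one (δ (suc l , t)) (V (zero , suc zero) (suc l , t))) (column-products l t))
  normalised (suc k , s) (zero , zero) =
    here (trans (drop-one′ (ε (suc k , s)) (ε (suc k , s))) (sign-square (ε-sign (suc k , s))))
  normalised (suc k , s) (zero , suc zero) =
    here (trans (drop-one′ (ε (suc k , s)) (V (suc k , s) (zero , suc zero))) (row-products k s))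
  normalised (suc k , s) (suc l , t) with k Fin.≟ l
  ... | yes refl = here (trans (cong (_*_ (ε (suc k , s) * δ (suc k , t))) (V-zero (suc k) {s} {t}))
                               (ℤ.*-zeroʳ (ε (suc k , s) * δ (suc k , t))))
  ... | no k≢l with sign-* (sign-* (ε-sign (suc k , s)) (δ-sign (suc l , t)))
                           (V-sign {suc k} {suc l} s t (k≢l ∘ Fin.suc-injective))
  ... | inj₁ p = here p
  ... | inj₂ p = there (here p)

  normalForm : NormalForm W
  normalForm = record
    { row              = row
    ; column           = column
    ; row-injective    = λ {i} {j} eq → remQuot-injective 2 (ρ-injective (proj₁ (index i)) (proj₁ (index j)) eq)
    ; column-injective = column-injective
    ; row-sign         = ε ∘ index
    ; column-sign      = δ ∘ index
    ; row-sign-sign    = ε-sign ∘ index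
    ; column-sign-sign = δ-sign ∘ index
    ; entry-choice     = λ i j → normalised (index i) (index j)
    ; orthogonal       = orth
    }
    where
    row column : Fin 12 → Fin 12
    row    i = uncurry ρ (index i)
    column j = uncurry κ (index j)

    column-injective : Injective _≡_ _≡_ column
    column-injective {i} {j} eq = remQuot-injective 2 (κ-injective (proj₁ (index i)) (proj₁ (index j)) eq)

    row-injective : Injective _≡_ _≡_ row
    row-injective {i} {j} eq = remQuot-injective 2 (ρ-injective (proj₁ (index i)) (proj₁ (index j)) eq)

    regroup : ∀ e f d v w → e * d * v * (f * d * w) ≡ e * f * (d * d * (v * w))
    regroup = solve-∀

    entry : Matrix 12
    entry i j = ε (index i) * δ (index j) * V (index i) (index j)

    orth : ∀ i j → i ≢ j → sum (λ c → entry i c * entry j c) ≡ + 0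
    orth i j i≢j = begin
      sum (λ c → entry i c * entry j c)
        ≡⟨ sum-cong-≗ (λ c → trans
             (regroup (ε (index i)) (ε (index j)) (δ (index c)) (V (index i) (index c)) (V (index j) (index c)))
             (cong (_*_ e) (sign-cancel _ (δ-sign (index c))))) ⟩
      sum (λ c → e * (W (row i) (column c) * W (row j) (column c)))
        ≡⟨ *-distribˡ-sum e (λ c → W (row i) (column c) * W (row j) (column c)) ⟨
      e * sum (λ c → W (row i) (column c) * W (row j) (column c))
        ≡⟨ cong (_*_ e) (sum-permute (λ c → W (row i) c * W (row j) c) (injective⇒permutation column column-injective)) ⟨
      e * sum (λ c → W (row i) c * W (row j) c)
        ≡⟨ cong (_*_ e) (row-orthogonal (i≢j ∘ row-injective)) ⟩
      e * + 0
        ≡⟨ ℤ.*-zeroʳ e ⟩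
      + 0 ∎
      where
      e = ε (index i) * ε (index j)

-- Enumeration of the normal forms

dot : ∀ {n} → Vec ℤ n → Vec ℤ n → ℤ
dot []       []       = + 0
dot (x ∷ xs) (y ∷ ys) = x * y + dot xs ys

Orthogonal : ∀ {n} → Vec ℤ n → Vec ℤ n → Set
Orthogonal v u = dot v u ≡ + 0

orthogonal? : ∀ {n} (v u : Vec ℤ n) → Dec (Orthogonal v u)
orthogonal? v u = dot v u ℤ.≟ + 0

sequences : ∀ {A : Set} {n} → Vec (List A) n → List (Vec A n)
sequences []         = [] ∷ []
sequences (xs ∷ xss) = cartesianProductWith _∷_ xs (sequences xss)

-- Backtracking with pruning: once a row is chosen, the candidates for all later rows are filtered.
-- Ten of the rows start with 256 candidates each, far too many to combine before testing
-- orthogonality.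
completions : ∀ {m n} → Vec (List (Vec ℤ n)) m → List (Vec (Vec ℤ n) m)
completions []       = [] ∷ []
completions (C ∷ Cs) =
  concatMap (λ v → List.map (v ∷_) (completions (Vec.map (filter (orthogonal? v)) Cs))) C

∈-sequences : ∀ {A : Set} {n} (xss : Vec (List A) n) {v} →
              (∀ i → lookup v i ∈ lookup xss i) → v ∈ sequences xss
∈-sequences []         {[]}    _  = here refl
∈-sequences (xs ∷ xss) {x ∷ v} v∈ =
  ∈-cartesianProductWith⁺ _∷_ (v∈ zero) (∈-sequences xss (v∈ ∘ suc))

∈-completions : ∀ {m n} (Cs : Vec (List (Vec ℤ n)) m) {vs} → (∀ i → lookup vs i ∈ lookup Cs i) →
                (∀ i j → i ≢ j → Orthogonal (lookup vs i) (lookup vs j)) → vs ∈ completions Cs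
∈-completions []       {[]}     _   _    = here refl
∈-completions (C ∷ Cs) {v ∷ vs} vs∈ orth =
  ∈-concatMap⁺ _ (Any.map (λ { refl → ∈-map⁺ (v ∷_) rest }) (vs∈ zero))
  where
  rest : vs ∈ completions (Vec.map (filter (orthogonal? v)) Cs)
  rest = ∈-completions (Vec.map (filter (orthogonal? v)) Cs)
    (λ i → subst (lookup vs i ∈_) (sym (Vec.lookup-map i (filter (orthogonal? v)) Cs))
                 (∈-filter⁺ (orthogonal? v) (vs∈ (suc i)) (orth zero (suc i) λ ())))
    (λ i j i≢j → orth (suc i) (suc j) (i≢j ∘ Fin.suc-injective))

dot-tabulate : ∀ {n} (f g : Vector ℤ n) → dot (Vec.tabulate f) (Vec.tabulate g) ≡ sum (λ c → f c * g c)
dot-tabulate {zero}  f g = refl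
dot-tabulate {suc n} f g = cong (_+_ (f zero * g zero)) (dot-tabulate (f ∘ suc) (g ∘ suc))

tabulate₂ : ∀ {n} → Matrix n → Vec (Vec ℤ n) n
tabulate₂ M = Vec.tabulate λ i → Vec.tabulate (M i)

lookup-tabulate₂ : ∀ {n} (M : Matrix n) i j → lookup (lookup (tabulate₂ M) i) j ≡ M i j
lookup-tabulate₂ M i j =
  trans (cong (λ r → lookup r j) (Vec.lookup∘tabulate (λ i → Vec.tabulate (M i)) i)) (Vec.lookup∘tabulate (M i) j)

matrices : ∀ {m n} → (Fin m → Fin n → List ℤ) → List (Vec (Vec ℤ n) m)
matrices ch = completions (Vec.tabulate λ i → sequences (Vec.tabulate (ch i)))

∈-matrices : ∀ {n} (ch : Fin n → Fin n → List ℤ) (M : Matrix n) → (∀ i j → M i j ∈ ch i j) →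
             (∀ i j → i ≢ j → sum (λ c → M i c * M j c) ≡ + 0) → tabulate₂ M ∈ matrices ch
∈-matrices ch M M∈ orth = ∈-completions (Vec.tabulate λ i → sequences (Vec.tabulate (ch i)))
  (λ i → subst₂ _∈_ (sym (row i)) (sym (Vec.lookup∘tabulate (λ i → sequences (Vec.tabulate (ch i))) i))
    (∈-sequences (Vec.tabulate (ch i)) λ j →
      subst₂ _∈_ (sym (Vec.lookup∘tabulate (M i) j)) (sym (Vec.lookup∘tabulate (ch i) j)) (M∈ i j)))
  (λ i j i≢j → subst₂ Orthogonal (sym (row i)) (sym (row j)) (trans (dot-tabulate (M i) (M j)) (orth i j i≢j)))
  where
  row : ∀ i → lookup (tabulate₂ M) i ≡ Vec.tabulate (M i)
  row = Vec.lookup∘tabulate (λ i → Vec.tabulate (M i))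

-- The five representatives and the certificates

⁺ ⁻ ∙ : ℤ
⁺ = + 1
⁻ = -[1+ 0 ]
∙ = + 0

-- All five are in normal form. The first is the Kronecker product of a symmetric conference matrix
-- C of order 6 with the Hadamard matrix of order 2. The second has the rows of C, with each entry
-- doubled, alternating with the rows of another conference matrix, with each entry `x` spread to
-- `x`, `-x`. The third is the transpose of the second.
representatives : Vec (Vec (Vec ℤ 12) 12) 5
representatives =
    ((∙ ∷ ∙ ∷ ⁺ ∷ ⁺ ∷ ⁺ ∷ ⁺ ∷ ⁺ ∷ ⁺ ∷ ⁺ ∷ ⁺ ∷ ⁺ ∷ ⁺ ∷ []) ∷
      (∙ ∷ ∙ ∷ ⁺ ∷ ⁻ ∷ ⁺ ∷ ⁻ ∷ ⁺ ∷ ⁻ ∷ ⁺ ∷ ⁻ ∷ ⁺ ∷ ⁻ ∷ []) ∷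
      (⁺ ∷ ⁺ ∷ ∙ ∷ ∙ ∷ ⁺ ∷ ⁺ ∷ ⁺ ∷ ⁺ ∷ ⁻ ∷ ⁻ ∷ ⁻ ∷ ⁻ ∷ []) ∷
      (⁺ ∷ ⁻ ∷ ∙ ∷ ∙ ∷ ⁺ ∷ ⁻ ∷ ⁺ ∷ ⁻ ∷ ⁻ ∷ ⁺ ∷ ⁻ ∷ ⁺ ∷ []) ∷
      (⁺ ∷ ⁺ ∷ ⁺ ∷ ⁺ ∷ ∙ ∷ ∙ ∷ ⁻ ∷ ⁻ ∷ ⁺ ∷ ⁺ ∷ ⁻ ∷ ⁻ ∷ []) ∷
      (⁺ ∷ ⁻ ∷ ⁺ ∷ ⁻ ∷ ∙ ∷ ∙ ∷ ⁻ ∷ ⁺ ∷ ⁺ ∷ ⁻ ∷ ⁻ ∷ ⁺ ∷ []) ∷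
      (⁺ ∷ ⁺ ∷ ⁺ ∷ ⁺ ∷ ⁻ ∷ ⁻ ∷ ∙ ∷ ∙ ∷ ⁻ ∷ ⁻ ∷ ⁺ ∷ ⁺ ∷ []) ∷
      (⁺ ∷ ⁻ ∷ ⁺ ∷ ⁻ ∷ ⁻ ∷ ⁺ ∷ ∙ ∷ ∙ ∷ ⁻ ∷ ⁺ ∷ ⁺ ∷ ⁻ ∷ []) ∷
      (⁺ ∷ ⁺ ∷ ⁻ ∷ ⁻ ∷ ⁺ ∷ ⁺ ∷ ⁻ ∷ ⁻ ∷ ∙ ∷ ∙ ∷ ⁺ ∷ ⁺ ∷ []) ∷
      (⁺ ∷ ⁻ ∷ ⁻ ∷ ⁺ ∷ ⁺ ∷ ⁻ ∷ ⁻ ∷ ⁺ ∷ ∙ ∷ ∙ ∷ ⁺ ∷ ⁻ ∷ []) ∷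
      (⁺ ∷ ⁺ ∷ ⁻ ∷ ⁻ ∷ ⁻ ∷ ⁻ ∷ ⁺ ∷ ⁺ ∷ ⁺ ∷ ⁺ ∷ ∙ ∷ ∙ ∷ []) ∷
      (⁺ ∷ ⁻ ∷ ⁻ ∷ ⁺ ∷ ⁻ ∷ ⁺ ∷ ⁺ ∷ ⁻ ∷ ⁺ ∷ ⁻ ∷ ∙ ∷ ∙ ∷ []) ∷ [])
  ∷ ((∙ ∷ ∙ ∷ ⁺ ∷ ⁺ ∷ ⁺ ∷ ⁺ ∷ ⁺ ∷ ⁺ ∷ ⁺ ∷ ⁺ ∷ ⁺ ∷ ⁺ ∷ []) ∷
      (∙ ∷ ∙ ∷ ⁺ ∷ ⁻ ∷ ⁺ ∷ ⁻ ∷ ⁺ ∷ ⁻ ∷ ⁺ ∷ ⁻ ∷ ⁺ ∷ ⁻ ∷ []) ∷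
      (⁺ ∷ ⁺ ∷ ∙ ∷ ∙ ∷ ⁺ ∷ ⁺ ∷ ⁺ ∷ ⁺ ∷ ⁻ ∷ ⁻ ∷ ⁻ ∷ ⁻ ∷ []) ∷
      (⁺ ∷ ⁻ ∷ ∙ ∷ ∙ ∷ ⁺ ∷ ⁻ ∷ ⁺ ∷ ⁻ ∷ ⁻ ∷ ⁺ ∷ ⁻ ∷ ⁺ ∷ []) ∷
      (⁺ ∷ ⁺ ∷ ⁺ ∷ ⁺ ∷ ∙ ∷ ∙ ∷ ⁻ ∷ ⁻ ∷ ⁺ ∷ ⁺ ∷ ⁻ ∷ ⁻ ∷ []) ∷
      (⁺ ∷ ⁻ ∷ ⁺ ∷ ⁻ ∷ ∙ ∷ ∙ ∷ ⁻ ∷ ⁺ ∷ ⁻ ∷ ⁺ ∷ ⁺ ∷ ⁻ ∷ []) ∷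
      (⁺ ∷ ⁺ ∷ ⁺ ∷ ⁺ ∷ ⁻ ∷ ⁻ ∷ ∙ ∷ ∙ ∷ ⁻ ∷ ⁻ ∷ ⁺ ∷ ⁺ ∷ []) ∷
      (⁺ ∷ ⁻ ∷ ⁺ ∷ ⁻ ∷ ⁻ ∷ ⁺ ∷ ∙ ∷ ∙ ∷ ⁺ ∷ ⁻ ∷ ⁻ ∷ ⁺ ∷ []) ∷
      (⁺ ∷ ⁺ ∷ ⁻ ∷ ⁻ ∷ ⁺ ∷ ⁺ ∷ ⁻ ∷ ⁻ ∷ ∙ ∷ ∙ ∷ ⁺ ∷ ⁺ ∷ []) ∷
      (⁺ ∷ ⁻ ∷ ⁻ ∷ ⁺ ∷ ⁻ ∷ ⁺ ∷ ⁺ ∷ ⁻ ∷ ∙ ∷ ∙ ∷ ⁺ ∷ ⁻ ∷ []) ∷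
      (⁺ ∷ ⁺ ∷ ⁻ ∷ ⁻ ∷ ⁻ ∷ ⁻ ∷ ⁺ ∷ ⁺ ∷ ⁺ ∷ ⁺ ∷ ∙ ∷ ∙ ∷ []) ∷
      (⁺ ∷ ⁻ ∷ ⁻ ∷ ⁺ ∷ ⁺ ∷ ⁻ ∷ ⁻ ∷ ⁺ ∷ ⁺ ∷ ⁻ ∷ ∙ ∷ ∙ ∷ []) ∷ [])
  ∷ ((∙ ∷ ∙ ∷ ⁺ ∷ ⁺ ∷ ⁺ ∷ ⁺ ∷ ⁺ ∷ ⁺ ∷ ⁺ ∷ ⁺ ∷ ⁺ ∷ ⁺ ∷ []) ∷
      (∙ ∷ ∙ ∷ ⁺ ∷ ⁻ ∷ ⁺ ∷ ⁻ ∷ ⁺ ∷ ⁻ ∷ ⁺ ∷ ⁻ ∷ ⁺ ∷ ⁻ ∷ []) ∷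
      (⁺ ∷ ⁺ ∷ ∙ ∷ ∙ ∷ ⁺ ∷ ⁺ ∷ ⁺ ∷ ⁺ ∷ ⁻ ∷ ⁻ ∷ ⁻ ∷ ⁻ ∷ []) ∷
      (⁺ ∷ ⁻ ∷ ∙ ∷ ∙ ∷ ⁺ ∷ ⁻ ∷ ⁺ ∷ ⁻ ∷ ⁻ ∷ ⁺ ∷ ⁻ ∷ ⁺ ∷ []) ∷
      (⁺ ∷ ⁺ ∷ ⁺ ∷ ⁺ ∷ ∙ ∷ ∙ ∷ ⁻ ∷ ⁻ ∷ ⁺ ∷ ⁻ ∷ ⁻ ∷ ⁺ ∷ []) ∷
      (⁺ ∷ ⁻ ∷ ⁺ ∷ ⁻ ∷ ∙ ∷ ∙ ∷ ⁻ ∷ ⁺ ∷ ⁺ ∷ ⁺ ∷ ⁻ ∷ ⁻ ∷ []) ∷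
      (⁺ ∷ ⁺ ∷ ⁺ ∷ ⁺ ∷ ⁻ ∷ ⁻ ∷ ∙ ∷ ∙ ∷ ⁻ ∷ ⁺ ∷ ⁺ ∷ ⁻ ∷ []) ∷
      (⁺ ∷ ⁻ ∷ ⁺ ∷ ⁻ ∷ ⁻ ∷ ⁺ ∷ ∙ ∷ ∙ ∷ ⁻ ∷ ⁻ ∷ ⁺ ∷ ⁺ ∷ []) ∷
      (⁺ ∷ ⁺ ∷ ⁻ ∷ ⁻ ∷ ⁺ ∷ ⁻ ∷ ⁻ ∷ ⁺ ∷ ∙ ∷ ∙ ∷ ⁺ ∷ ⁺ ∷ []) ∷
      (⁺ ∷ ⁻ ∷ ⁻ ∷ ⁺ ∷ ⁺ ∷ ⁺ ∷ ⁻ ∷ ⁻ ∷ ∙ ∷ ∙ ∷ ⁺ ∷ ⁻ ∷ []) ∷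
      (⁺ ∷ ⁺ ∷ ⁻ ∷ ⁻ ∷ ⁻ ∷ ⁺ ∷ ⁺ ∷ ⁻ ∷ ⁺ ∷ ⁺ ∷ ∙ ∷ ∙ ∷ []) ∷
      (⁺ ∷ ⁻ ∷ ⁻ ∷ ⁺ ∷ ⁻ ∷ ⁻ ∷ ⁺ ∷ ⁺ ∷ ⁺ ∷ ⁻ ∷ ∙ ∷ ∙ ∷ []) ∷ [])
  ∷ ((∙ ∷ ∙ ∷ ⁺ ∷ ⁺ ∷ ⁺ ∷ ⁺ ∷ ⁺ ∷ ⁺ ∷ ⁺ ∷ ⁺ ∷ ⁺ ∷ ⁺ ∷ []) ∷
      (∙ ∷ ∙ ∷ ⁺ ∷ ⁻ ∷ ⁺ ∷ ⁻ ∷ ⁺ ∷ ⁻ ∷ ⁺ ∷ ⁻ ∷ ⁺ ∷ ⁻ ∷ []) ∷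
      (⁺ ∷ ⁺ ∷ ∙ ∷ ∙ ∷ ⁺ ∷ ⁺ ∷ ⁺ ∷ ⁺ ∷ ⁻ ∷ ⁻ ∷ ⁻ ∷ ⁻ ∷ []) ∷
      (⁺ ∷ ⁻ ∷ ∙ ∷ ∙ ∷ ⁺ ∷ ⁻ ∷ ⁺ ∷ ⁻ ∷ ⁻ ∷ ⁺ ∷ ⁻ ∷ ⁺ ∷ []) ∷
      (⁺ ∷ ⁺ ∷ ⁺ ∷ ⁺ ∷ ∙ ∷ ∙ ∷ ⁻ ∷ ⁻ ∷ ⁺ ∷ ⁻ ∷ ⁻ ∷ ⁺ ∷ []) ∷
      (⁺ ∷ ⁻ ∷ ⁺ ∷ ⁻ ∷ ∙ ∷ ∙ ∷ ⁻ ∷ ⁺ ∷ ⁻ ∷ ⁻ ∷ ⁺ ∷ ⁺ ∷ []) ∷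
      (⁺ ∷ ⁺ ∷ ⁺ ∷ ⁺ ∷ ⁻ ∷ ⁻ ∷ ∙ ∷ ∙ ∷ ⁻ ∷ ⁺ ∷ ⁺ ∷ ⁻ ∷ []) ∷
      (⁺ ∷ ⁻ ∷ ⁺ ∷ ⁻ ∷ ⁻ ∷ ⁺ ∷ ∙ ∷ ∙ ∷ ⁺ ∷ ⁺ ∷ ⁻ ∷ ⁻ ∷ []) ∷
      (⁺ ∷ ⁺ ∷ ⁻ ∷ ⁻ ∷ ⁻ ∷ ⁺ ∷ ⁺ ∷ ⁻ ∷ ∙ ∷ ∙ ∷ ⁺ ∷ ⁺ ∷ []) ∷
      (⁺ ∷ ⁻ ∷ ⁻ ∷ ⁺ ∷ ⁺ ∷ ⁺ ∷ ⁻ ∷ ⁻ ∷ ∙ ∷ ∙ ∷ ⁺ ∷ ⁻ ∷ []) ∷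
      (⁺ ∷ ⁺ ∷ ⁻ ∷ ⁻ ∷ ⁺ ∷ ⁻ ∷ ⁻ ∷ ⁺ ∷ ⁺ ∷ ⁺ ∷ ∙ ∷ ∙ ∷ []) ∷
      (⁺ ∷ ⁻ ∷ ⁻ ∷ ⁺ ∷ ⁻ ∷ ⁻ ∷ ⁺ ∷ ⁺ ∷ ⁺ ∷ ⁻ ∷ ∙ ∷ ∙ ∷ []) ∷ [])
  ∷ ((∙ ∷ ∙ ∷ ⁺ ∷ ⁺ ∷ ⁺ ∷ ⁺ ∷ ⁺ ∷ ⁺ ∷ ⁺ ∷ ⁺ ∷ ⁺ ∷ ⁺ ∷ []) ∷
      (∙ ∷ ∙ ∷ ⁺ ∷ ⁻ ∷ ⁺ ∷ ⁻ ∷ ⁺ ∷ ⁻ ∷ ⁺ ∷ ⁻ ∷ ⁺ ∷ ⁻ ∷ []) ∷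
      (⁺ ∷ ⁺ ∷ ∙ ∷ ∙ ∷ ⁺ ∷ ⁺ ∷ ⁺ ∷ ⁻ ∷ ⁻ ∷ ⁺ ∷ ⁻ ∷ ⁻ ∷ []) ∷
      (⁺ ∷ ⁻ ∷ ∙ ∷ ∙ ∷ ⁺ ∷ ⁻ ∷ ⁻ ∷ ⁻ ∷ ⁺ ∷ ⁺ ∷ ⁻ ∷ ⁺ ∷ []) ∷
      (⁺ ∷ ⁺ ∷ ⁻ ∷ ⁻ ∷ ∙ ∷ ∙ ∷ ⁺ ∷ ⁺ ∷ ⁺ ∷ ⁻ ∷ ⁻ ∷ ⁺ ∷ []) ∷
      (⁺ ∷ ⁻ ∷ ⁻ ∷ ⁺ ∷ ∙ ∷ ∙ ∷ ⁺ ∷ ⁻ ∷ ⁻ ∷ ⁻ ∷ ⁺ ∷ ⁺ ∷ []) ∷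
      (⁺ ∷ ⁺ ∷ ⁻ ∷ ⁺ ∷ ⁻ ∷ ⁻ ∷ ∙ ∷ ∙ ∷ ⁺ ∷ ⁺ ∷ ⁺ ∷ ⁻ ∷ []) ∷
      (⁺ ∷ ⁻ ∷ ⁺ ∷ ⁺ ∷ ⁻ ∷ ⁺ ∷ ∙ ∷ ∙ ∷ ⁺ ∷ ⁻ ∷ ⁻ ∷ ⁻ ∷ []) ∷
      (⁺ ∷ ⁺ ∷ ⁺ ∷ ⁻ ∷ ⁻ ∷ ⁺ ∷ ⁻ ∷ ⁻ ∷ ∙ ∷ ∙ ∷ ⁺ ∷ ⁺ ∷ []) ∷
      (⁺ ∷ ⁻ ∷ ⁻ ∷ ⁻ ∷ ⁺ ∷ ⁺ ∷ ⁻ ∷ ⁺ ∷ ∙ ∷ ∙ ∷ ⁺ ∷ ⁻ ∷ []) ∷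
      (⁺ ∷ ⁺ ∷ ⁺ ∷ ⁺ ∷ ⁺ ∷ ⁻ ∷ ⁻ ∷ ⁺ ∷ ⁻ ∷ ⁻ ∷ ∙ ∷ ∙ ∷ []) ∷
      (⁺ ∷ ⁻ ∷ ⁺ ∷ ⁻ ∷ ⁻ ∷ ⁻ ∷ ⁺ ∷ ⁺ ∷ ⁻ ∷ ⁺ ∷ ∙ ∷ ∙ ∷ []) ∷ [])
  ∷ []

representative : Fin 5 → Matrix 12
representative a i j = lookup (lookup (lookup representatives a) i) j

gather : ∀ {A : Set} {m n k l} → Vec (Vec A n) m → Vec (Fin m) k → Vec (Fin n) l → Vec (Vec A l) k
gather M rs cs = Vec.map (λ r → Vec.map (lookup (lookup M r)) cs) rs

scale : ∀ {m n} → Vec ℤ m → Vec ℤ n → Vec (Vec ℤ n) m → Vec (Vec ℤ n) m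
scale es ds M = Vec.zipWith (λ e → Vec.zipWith (λ d x → e * d * x) ds) es M

lookup-scale-gather : ∀ {m n k l} (es : Vec ℤ k) (ds : Vec ℤ l) (M : Vec (Vec ℤ n) m) rs cs i j →
  lookup (lookup (scale es ds (gather M rs cs)) i) j ≡
  lookup es i * lookup ds j * lookup (lookup M (lookup rs i)) (lookup cs j)
lookup-scale-gather es ds M rs cs i j = begin
  lookup (lookup (scale es ds (gather M rs cs)) i) j
    ≡⟨ cong (λ r → lookup r j) (Vec.lookup-zipWith _ i es (gather M rs cs)) ⟩
  lookup (Vec.zipWith _ ds (lookup (gather M rs cs) i)) j
    ≡⟨ Vec.lookup-zipWith _ j ds (lookup (gather M rs cs) i) ⟩
  lookup es i * lookup ds j * lookup (lookup (gather M rs cs) i) j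
    ≡⟨ cong (λ r → lookup es i * lookup ds j * lookup r j) (Vec.lookup-map i _ rs) ⟩
  lookup es i * lookup ds j * lookup (Vec.map (lookup (lookup M (lookup rs i))) cs) j
    ≡⟨ cong (_*_ (lookup es i * lookup ds j)) (Vec.lookup-map j _ cs) ⟩
  lookup es i * lookup ds j * lookup (lookup M (lookup rs i)) (lookup cs j) ∎

record Transforms {n} (R L : Vec (Vec ℤ n) n) (rs cs : Vec (Fin n) n) (es ds : Vec ℤ n) : Set where
  constructor transforms
  field
    rows-unique    : UniqueVec rs
    columns-unique : UniqueVec cs
    row-signs      : ∀ i → IsSign (lookup es i)
    column-signs   : ∀ j → IsSign (lookup ds j)
    agrees         : L ≡ scale es ds (gather R rs cs)

isSign? : ∀ x → Dec (IsSign x)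
isSign? x = (x ℤ.≟ + 1) ⊎-dec (x ℤ.≟ -[1+ 0 ])

transforms? : ∀ {n} (R L : Vec (Vec ℤ n) n) rs cs es ds → Dec (Transforms R L rs cs es ds)
transforms? R L rs cs es ds = map′
  (λ { (ru , cu , re , ce , a) → transforms ru cu re ce a })
  (λ { (transforms ru cu re ce a) → ru , cu , re , ce , a })
  (unique? rs ×-dec unique? cs ×-dec Fin.all? (isSign? ∘ lookup es) ×-dec Fin.all? (isSign? ∘ lookup ds)
   ×-dec Vec.≡-dec (Vec.≡-dec ℤ._≟_) L (scale es ds (gather R rs cs)))
  where
  unique? = allPairs? (λ i j → ¬? (i Fin.≟ j))

-- The code of a transformation is 5 Σₖ 24ᵏ (4 bₖ + 2 rₖ + cₖ) + a: it moves block bₖ of the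
-- representative a to block k, exchanging its rows if rₖ = 1 and its columns if cₖ = 1; the
-- signs are those that make the first row and the first column nonnegative.
class : ℕ → Fin 5
class n = n mod 5

digits : ∀ k → ℕ → Vec (Fin 24) k
digits zero    n = []
digits (suc k) n = (n mod 24) ∷ digits k (n / 24)

places : (Fin 4 → Fin 2) → ℕ → Vec (Fin 12) 12
places swap n = Vec.concat (Vec.map pair (digits 6 (n / 5)))
  where
  pair : Fin 24 → Vec (Fin 12) 2
  pair d with remQuot {6} 4 d
  ... | b , s = combine b (swap s) ∷ combine b (Fin.opposite (swap s)) ∷ []

rowPlaces columnPlaces : ℕ → Vec (Fin 12) 12
rowPlaces    = places (Fin.quotient 2)
columnPlaces = places (Fin.remainder {2} 2)

-- The first two entries lie in the zero block of the gathered matrix, so they provide no sign and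
-- are replaced by 1.
normalising : Vec ℤ 12 → Vec ℤ 12
normalising (_ ∷ _ ∷ es) = + 1 ∷ + 1 ∷ es

Certifies : Vec (Vec ℤ 12) 12 → ℕ → Set
Certifies L n = Transforms R L rs cs (normalising (Vec.map Vec.head G)) (normalising (Vec.head G))
  where
  R  = lookup representatives (class n)
  rs = rowPlaces n
  cs = columnPlaces n
  G  = gather R rs cs

certifies? : ∀ L n → Dec (Certifies L n)
certifies? L n = transforms? _ _ _ _ _ _

-- One code for each normal form, in the order in which the search produces them. How the codes were
-- found does not matter, since each is checked against its matrix.
codes : List ℕ
codes =
  823657440 ∷ 823657441 ∷ 823657442 ∷ 823657443 ∷ 671040483 ∷ 671040482 ∷ 671040481 ∷ 671040480 ∷
  179771521 ∷ 485800326 ∷ 816492486 ∷ 512053441 ∷ 511258566 ∷ 817287361 ∷ 485005441 ∷ 180566406 ∷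
  817287366 ∷ 511258561 ∷ 180566401 ∷ 485005446 ∷ 485800321 ∷ 179771526 ∷ 512053446 ∷ 816492481 ∷
  823657446 ∷ 823657445 ∷ 823657448 ∷ 823657447 ∷ 671040487 ∷ 671040488 ∷ 671040485 ∷ 671040486 ∷
  179771522 ∷ 816492492 ∷ 485800332 ∷ 512053442 ∷ 173412483 ∷ 512053443 ∷ 326559378 ∷ 823657444 ∷
  816492498 ∷ 670775539 ∷ 173412488 ∷ 512053448 ∷ 326559373 ∷ 823657449 ∷ 816492493 ∷ 670775534 ∷
  179771527 ∷ 816492497 ∷ 485800337 ∷ 512053447 ∷ 511258572 ∷ 485005442 ∷ 817287362 ∷ 180566412 ∷
  326029443 ∷ 817287363 ∷ 173942418 ∷ 671040484 ∷ 511258578 ∷ 823392499 ∷ 326029448 ∷ 817287368 ∷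
  173942413 ∷ 671040489 ∷ 511258573 ∷ 823392494 ∷ 511258577 ∷ 485005447 ∷ 817287367 ∷ 180566417 ∷
  179771523 ∷ 505694403 ∷ 651698419 ∷ 803774418 ∷ 817298404 ∷ 351995538 ∷ 173412482 ∷ 511236492 ∷
  803774412 ∷ 505694402 ∷ 173412487 ∷ 511236497 ∷ 803774417 ∷ 505694407 ∷ 179771528 ∷ 505694408 ∷
  651698414 ∷ 803774413 ∷ 817298409 ∷ 351995533 ∷ 485005443 ∷ 658311363 ∷ 346464499 ∷ 193306578 ∷
  512064484 ∷ 809846418 ∷ 816470412 ∷ 326029442 ∷ 658311362 ∷ 193306572 ∷ 816470417 ∷ 326029447 ∷
  658311367 ∷ 193306577 ∷ 485005448 ∷ 658311368 ∷ 346464494 ∷ 193306573 ∷ 512064489 ∷ 809846413 ∷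
  173412481 ∷ 511236486 ∷ 803774406 ∷ 505694401 ∷ 817298400 ∷ 817298401 ∷ 817298402 ∷ 817298403 ∷
  658322403 ∷ 658322402 ∷ 658322401 ∷ 658322400 ∷ 823646401 ∷ 485822406 ∷ 193284486 ∷ 491364481 ∷
  485822401 ∷ 823646406 ∷ 491364486 ∷ 193284481 ∷ 817298406 ∷ 817298405 ∷ 817298408 ∷ 817298407 ∷
  658322407 ∷ 658322408 ∷ 658322405 ∷ 658322406 ∷ 511236481 ∷ 173412486 ∷ 505694406 ∷ 803774401 ∷
  823646402 ∷ 485822412 ∷ 193284492 ∷ 491364482 ∷ 823646403 ∷ 338747523 ∷ 485822418 ∷ 810674419 ∷
  658322404 ∷ 193019538 ∷ 823646408 ∷ 338747528 ∷ 485822413 ∷ 810674414 ∷ 658322409 ∷ 193019533 ∷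
  823646407 ∷ 485822417 ∷ 193284497 ∷ 491364487 ∷ 671029443 ∷ 491364483 ∷ 180588498 ∷ 352823539 ∷
  505705444 ∷ 803487378 ∷ 671029442 ∷ 180588492 ∷ 803752332 ∷ 338747522 ∷ 671029447 ∷ 180588497 ∷
  803752337 ∷ 338747527 ∷ 671029448 ∷ 491364488 ∷ 180588493 ∷ 352823534 ∷ 505705449 ∷ 803487373 ∷
  816470406 ∷ 326029441 ∷ 658311361 ∷ 193306566 ∷ 671029441 ∷ 180588486 ∷ 803752326 ∷ 338747521 ∷
  512064480 ∷ 512064481 ∷ 512064482 ∷ 512064483 ∷ 505705443 ∷ 505705442 ∷ 505705441 ∷ 505705440 ∷
  512064486 ∷ 512064485 ∷ 512064488 ∷ 512064487 ∷ 505705447 ∷ 505705448 ∷ 505705445 ∷ 505705446 ∷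
  180588481 ∷ 671029446 ∷ 338747526 ∷ 803752321 ∷ 326029446 ∷ 816470401 ∷ 193306561 ∷ 658311366 ∷
  817287372 ∷ 180566402 ∷ 511258562 ∷ 485005452 ∷ 817287373 ∷ 326029453 ∷ 173942408 ∷ 671040494 ∷
  511258568 ∷ 823392489 ∷ 817287378 ∷ 326029458 ∷ 173942403 ∷ 671040499 ∷ 511258563 ∷ 823392484 ∷
  817287377 ∷ 180566407 ∷ 511258567 ∷ 485005457 ∷ 485800322 ∷ 512053452 ∷ 179771532 ∷ 816492482 ∷
  512053453 ∷ 173412493 ∷ 326559368 ∷ 823657454 ∷ 816492488 ∷ 670775529 ∷ 512053458 ∷ 173412498 ∷
  326559363 ∷ 823657459 ∷ 816492483 ∷ 670775524 ∷ 485800327 ∷ 512053457 ∷ 179771537 ∷ 816492487 ∷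
  823657452 ∷ 823657453 ∷ 823657450 ∷ 823657451 ∷ 671040491 ∷ 671040490 ∷ 671040493 ∷ 671040492 ∷
  179771531 ∷ 485800336 ∷ 816492496 ∷ 512053451 ∷ 511258576 ∷ 817287371 ∷ 485005451 ∷ 180566416 ∷
  817287376 ∷ 511258571 ∷ 180566411 ∷ 485005456 ∷ 485800331 ∷ 179771536 ∷ 512053456 ∷ 816492491 ∷
  823657458 ∷ 823657457 ∷ 823657456 ∷ 823657455 ∷ 671040495 ∷ 671040496 ∷ 671040497 ∷ 671040498 ∷
  485822402 ∷ 823646412 ∷ 491364492 ∷ 193284482 ∷ 823646413 ∷ 338747533 ∷ 485822408 ∷ 810674409 ∷
  658322414 ∷ 193019528 ∷ 823646418 ∷ 338747538 ∷ 485822403 ∷ 810674404 ∷ 658322419 ∷ 193019523 ∷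
  485822407 ∷ 823646417 ∷ 491364497 ∷ 193284487 ∷ 173412491 ∷ 511236496 ∷ 803774416 ∷ 505694411 ∷
  817298412 ∷ 817298413 ∷ 817298410 ∷ 817298411 ∷ 658322411 ∷ 658322410 ∷ 658322413 ∷ 658322412 ∷
  823646411 ∷ 485822416 ∷ 193284496 ∷ 491364491 ∷ 485822411 ∷ 823646416 ∷ 491364496 ∷ 193284491 ∷
  817298418 ∷ 817298417 ∷ 817298416 ∷ 817298415 ∷ 658322415 ∷ 658322416 ∷ 658322417 ∷ 658322418 ∷
  511236491 ∷ 173412496 ∷ 505694416 ∷ 803774411 ∷ 816470416 ∷ 326029451 ∷ 658311371 ∷ 193306576 ∷
  671029451 ∷ 180588496 ∷ 803752336 ∷ 338747531 ∷ 512064492 ∷ 512064493 ∷ 512064490 ∷ 512064491 ∷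
  505705451 ∷ 505705450 ∷ 505705453 ∷ 505705452 ∷ 512064498 ∷ 512064497 ∷ 512064496 ∷ 512064495 ∷
  505705455 ∷ 505705456 ∷ 505705457 ∷ 505705458 ∷ 180588491 ∷ 671029456 ∷ 338747536 ∷ 803752331 ∷
  326029456 ∷ 816470411 ∷ 193306571 ∷ 658311376 ∷ 671029453 ∷ 491364493 ∷ 180588488 ∷ 352823529 ∷
  505705454 ∷ 803487368 ∷ 180588482 ∷ 671029452 ∷ 338747532 ∷ 803752322 ∷ 180588487 ∷ 671029457 ∷
  338747537 ∷ 803752327 ∷ 671029458 ∷ 491364498 ∷ 180588483 ∷ 352823524 ∷ 505705459 ∷ 803487363 ∷
  179771533 ∷ 505694413 ∷ 817298414 ∷ 351995528 ∷ 651698409 ∷ 803774408 ∷ 511236482 ∷ 173412492 ∷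
  505694412 ∷ 803774402 ∷ 511236487 ∷ 173412497 ∷ 505694417 ∷ 803774407 ∷ 179771538 ∷ 505694418 ∷
  817298419 ∷ 351995523 ∷ 651698404 ∷ 803774403 ∷ 485005453 ∷ 658311373 ∷ 512064494 ∷ 809846408 ∷
  346464489 ∷ 193306568 ∷ 326029452 ∷ 816470402 ∷ 193306562 ∷ 658311372 ∷ 326029457 ∷ 816470407 ∷
  193306567 ∷ 658311377 ∷ 485005458 ∷ 658311378 ∷ 512064499 ∷ 809846403 ∷ 346464484 ∷ 193306563 ∷
  180566403 ∷ 816768484 ∷ 504634563 ∷ 651168499 ∷ 352525458 ∷ 804039378 ∷ 511501457 ∷ 173942407 ∷
  504634567 ∷ 804039377 ∷ 511501452 ∷ 173942402 ∷ 504634562 ∷ 804039372 ∷ 180566408 ∷ 816768489 ∷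
  504634568 ∷ 651168494 ∷ 352525453 ∷ 804039373 ∷ 485800323 ∷ 511534564 ∷ 657251523 ∷ 345934579 ∷
  810376338 ∷ 193571538 ∷ 326559367 ∷ 816735377 ∷ 193571537 ∷ 657251527 ∷ 326559362 ∷ 816735372 ∷
  193571532 ∷ 657251522 ∷ 485800328 ∷ 511534569 ∷ 657251528 ∷ 345934574 ∷ 810376333 ∷ 193571533 ∷
  485557443 ∷ 657527539 ∷ 810409444 ∷ 193284483 ∷ 823116498 ∷ 339807378 ∷ 485557447 ∷ 823116497 ∷
  492424337 ∷ 193019527 ∷ 485557442 ∷ 823116492 ∷ 492424332 ∷ 193019522 ∷ 485557448 ∷ 657527534 ∷
  810409449 ∷ 193284488 ∷ 823116493 ∷ 339807373 ∷ 511501456 ∷ 173942411 ∷ 504634571 ∷ 804039376 ∷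
  485557451 ∷ 823116496 ∷ 492424336 ∷ 193019531 ∷ 810409458 ∷ 816768497 ∷ 816768496 ∷ 816768495 ∷
  810409455 ∷ 810409456 ∷ 810409457 ∷ 816768498 ∷ 816768492 ∷ 810409453 ∷ 816768490 ∷ 816768491 ∷
  810409451 ∷ 810409450 ∷ 816768493 ∷ 810409452 ∷ 823116491 ∷ 485557456 ∷ 193019536 ∷ 492424331 ∷
  173942416 ∷ 511501451 ∷ 804039371 ∷ 504634576 ∷ 326559371 ∷ 816735376 ∷ 193571536 ∷ 657251531 ∷
  352558578 ∷ 511534577 ∷ 511534576 ∷ 511534575 ∷ 352558575 ∷ 352558576 ∷ 352558577 ∷ 511534578 ∷
  180323531 ∷ 670499536 ∷ 339807376 ∷ 803487371 ∷ 670499531 ∷ 180323536 ∷ 803487376 ∷ 339807371 ∷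
  511534572 ∷ 352558573 ∷ 511534570 ∷ 511534571 ∷ 352558571 ∷ 352558570 ∷ 511534573 ∷ 352558572 ∷
  816735371 ∷ 326559376 ∷ 657251536 ∷ 193571531 ∷ 180323527 ∷ 670499537 ∷ 339807377 ∷ 803487367 ∷
  180323523 ∷ 504910579 ∷ 352558564 ∷ 803752323 ∷ 670499538 ∷ 492424338 ∷ 180323528 ∷ 504910574 ∷
  352558569 ∷ 803752328 ∷ 670499533 ∷ 492424333 ∷ 180323522 ∷ 670499532 ∷ 339807372 ∷ 803487362 ∷
  339840498 ∷ 492457457 ∷ 492457456 ∷ 492457455 ∷ 339840495 ∷ 339840496 ∷ 339840497 ∷ 492457458 ∷
  351995531 ∷ 810376336 ∷ 187212496 ∷ 644533451 ∷ 645063376 ∷ 186682571 ∷ 809846411 ∷ 352525456 ∷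
  186682576 ∷ 645063371 ∷ 352525451 ∷ 809846416 ∷ 810376331 ∷ 351995536 ∷ 644533456 ∷ 187212491 ∷
  492457452 ∷ 339840493 ∷ 492457450 ∷ 492457451 ∷ 339840491 ∷ 339840490 ∷ 492457453 ∷ 339840492 ∷
  351995527 ∷ 187212497 ∷ 810376337 ∷ 644533447 ∷ 492457444 ∷ 511236483 ∷ 339575539 ∷ 644533443 ∷
  187212498 ∷ 816735378 ∷ 492457449 ∷ 511236488 ∷ 339575534 ∷ 644533448 ∷ 187212493 ∷ 816735373 ∷
  351995522 ∷ 187212492 ∷ 810376332 ∷ 644533442 ∷ 645063377 ∷ 809846407 ∷ 186682567 ∷ 352525457 ∷
  339840484 ∷ 816470403 ∷ 492192499 ∷ 186682563 ∷ 645063378 ∷ 511501458 ∷ 339840489 ∷ 816470408 ∷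
  492192494 ∷ 186682568 ∷ 645063373 ∷ 511501453 ∷ 645063372 ∷ 809846402 ∷ 186682562 ∷ 352525452 ∷
  511501446 ∷ 173942401 ∷ 504634561 ∷ 804039366 ∷ 485557441 ∷ 823116486 ∷ 492424326 ∷ 193019521 ∷
  816768486 ∷ 816768485 ∷ 810409448 ∷ 816768487 ∷ 810409447 ∷ 816768488 ∷ 810409445 ∷ 810409446 ∷
  816768480 ∷ 816768481 ∷ 816768482 ∷ 810409443 ∷ 816768483 ∷ 810409442 ∷ 810409441 ∷ 810409440 ∷
  823116481 ∷ 485557446 ∷ 193019526 ∷ 492424321 ∷ 173942406 ∷ 511501441 ∷ 804039361 ∷ 504634566 ∷
  485557453 ∷ 657527529 ∷ 810409454 ∷ 193284493 ∷ 823116488 ∷ 339807368 ∷ 823116487 ∷ 485557457 ∷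
  193019537 ∷ 492424327 ∷ 823116482 ∷ 485557452 ∷ 193019532 ∷ 492424322 ∷ 485557458 ∷ 657527524 ∷
  810409459 ∷ 193284498 ∷ 823116483 ∷ 339807363 ∷ 670499527 ∷ 180323537 ∷ 803487377 ∷ 339807367 ∷
  180323533 ∷ 504910569 ∷ 352558574 ∷ 803752333 ∷ 670499528 ∷ 492424328 ∷ 180323538 ∷ 504910564 ∷
  352558579 ∷ 803752338 ∷ 670499523 ∷ 492424323 ∷ 670499522 ∷ 180323532 ∷ 803487372 ∷ 339807362 ∷
  326559361 ∷ 816735366 ∷ 193571526 ∷ 657251521 ∷ 511534566 ∷ 511534565 ∷ 352558568 ∷ 511534567 ∷
  352558567 ∷ 511534568 ∷ 352558565 ∷ 352558566 ∷ 180323521 ∷ 670499526 ∷ 339807366 ∷ 803487361 ∷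
  670499521 ∷ 180323526 ∷ 803487366 ∷ 339807361 ∷ 511534560 ∷ 511534561 ∷ 511534562 ∷ 352558563 ∷
  511534563 ∷ 352558562 ∷ 352558561 ∷ 352558560 ∷ 816735361 ∷ 326559366 ∷ 657251526 ∷ 193571521 ∷
  504634573 ∷ 651168489 ∷ 180566413 ∷ 816768494 ∷ 352525448 ∷ 804039368 ∷ 173942417 ∷ 511501447 ∷
  804039367 ∷ 504634577 ∷ 173942412 ∷ 511501442 ∷ 804039362 ∷ 504634572 ∷ 504634578 ∷ 651168484 ∷
  180566418 ∷ 816768499 ∷ 352525443 ∷ 804039363 ∷ 657251533 ∷ 345934569 ∷ 485800333 ∷ 511534574 ∷
  810376328 ∷ 193571528 ∷ 816735367 ∷ 326559377 ∷ 657251537 ∷ 193571527 ∷ 816735362 ∷ 326559372 ∷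
  657251532 ∷ 193571522 ∷ 657251538 ∷ 345934564 ∷ 485800338 ∷ 511534579 ∷ 810376323 ∷ 193571523 ∷
  186682577 ∷ 352525447 ∷ 645063367 ∷ 809846417 ∷ 339840494 ∷ 816470413 ∷ 492192489 ∷ 186682573 ∷
  511501448 ∷ 645063368 ∷ 339840499 ∷ 816470418 ∷ 492192484 ∷ 186682578 ∷ 511501443 ∷ 645063363 ∷
  186682572 ∷ 352525442 ∷ 645063362 ∷ 809846412 ∷ 810376327 ∷ 644533457 ∷ 351995537 ∷ 187212487 ∷
  492457454 ∷ 511236493 ∷ 339575529 ∷ 644533453 ∷ 816735368 ∷ 187212488 ∷ 492457459 ∷ 511236498 ∷
  339575524 ∷ 644533458 ∷ 816735363 ∷ 187212483 ∷ 810376322 ∷ 644533452 ∷ 351995532 ∷ 187212482 ∷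
  492457446 ∷ 492457445 ∷ 339840488 ∷ 492457447 ∷ 339840487 ∷ 492457448 ∷ 339840485 ∷ 339840486 ∷
  351995521 ∷ 810376326 ∷ 187212486 ∷ 644533441 ∷ 645063366 ∷ 186682561 ∷ 809846401 ∷ 352525446 ∷
  186682566 ∷ 645063361 ∷ 352525441 ∷ 809846406 ∷ 810376321 ∷ 351995526 ∷ 644533446 ∷ 187212481 ∷
  492457440 ∷ 492457441 ∷ 492457442 ∷ 339840483 ∷ 492457443 ∷ 339840482 ∷ 339840481 ∷ 339840480 ∷ []

normalForms : List (Vec (Vec ℤ 12) 12)
normalForms = matrices λ i j → choice (index i) (index j)

abstract
  -- Proved by evaluation, which runs the search and tests every certificate. As `Pointwise` relates
  -- only lists of equal length, this also confirms that the search ends with exactly as many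
  -- matrices as there are codes.
  certified : Pointwise Certifies normalForms codes
  certified = toWitness {a? = Pointwise.decidable certifies? normalForms codes} _

-- Equivalence as signed relabelling

-- Equivalence entry by entry, without matrix products: the form in which certificates arrive and in
-- which invariance is easy to prove.
record SignedRelabelling {n} (W R : Matrix n) : Set where
  field
    row column           : Permutation n n
    row-sign column-sign : Fin n → ℤ
    row-sign-sign        : ∀ i → IsSign (row-sign i)
    column-sign-sign     : ∀ j → IsSign (column-sign j)
    entry                : ∀ i j → W i j ≡ row-sign i * column-sign j * R (row ⟨$⟩ʳ i) (column ⟨$⟩ʳ j)

monomial : ∀ {n} → Permutation n n → (Fin n → ℤ) → Matrix n
monomial f e i l with f ⟨$⟩ʳ i Fin.≟ l
... | yes _ = e i
... | no  _ = + 0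

monomial-on : ∀ {n} (f : Permutation n n) e i → monomial f e i (f ⟨$⟩ʳ i) ≡ e i
monomial-on f e i with f ⟨$⟩ʳ i Fin.≟ f ⟨$⟩ʳ i
... | yes _   = refl
... | no  f≢f = contradiction refl f≢f

monomial-off : ∀ {n} (f : Permutation n n) e {i l} → f ⟨$⟩ʳ i ≢ l → monomial f e i l ≡ + 0
monomial-off f e {i} {l} f≢l with f ⟨$⟩ʳ i Fin.≟ l
... | yes f≡l = contradiction f≡l f≢l
... | no  _   = refl

monomial-isSignedMonomial : ∀ {n} (f : Permutation n n) {e} → (∀ i → IsSign (e i)) →
                            IsSignedMonomial n (monomial f e)
monomial-isSignedMonomial f {e} e-sign = entries , rows , columns
  where
  entries : ∀ i j → IsSignOrZero (monomial f e i j)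
  entries i j with f ⟨$⟩ʳ i Fin.≟ j
  ... | no _ = inj₂ (inj₂ refl)
  ... | yes _ with e-sign i
  ... | inj₁ p = inj₁ p
  ... | inj₂ p = inj₂ (inj₁ p)

  on≢0 : ∀ i → monomial f e i (f ⟨$⟩ʳ i) ≢ + 0
  on≢0 i = subst (_≢ + 0) (sym (monomial-on f e i)) (sign≢0 (e-sign i))

  support : ∀ {i l} → monomial f e i l ≢ + 0 → l ≡ f ⟨$⟩ʳ i
  support {i} {l} m≢0 with f ⟨$⟩ʳ i Fin.≟ l
  ... | yes f≡l = sym f≡l
  ... | no  _   = contradiction refl m≢0

  rows : ∀ i → Σ (Fin _) λ j → (monomial f e i j ≢ + 0) × (∀ j' → monomial f e i j' ≢ + 0 → j' ≡ j)
  rows i = f ⟨$⟩ʳ i , on≢0 i , λ _ → support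

  columns : ∀ j → Σ (Fin _) λ i → (monomial f e i j ≢ + 0) × (∀ i' → monomial f e i' j ≢ + 0 → i' ≡ i)
  columns j = f ⟨$⟩ˡ j , subst (λ l → monomial f e (f ⟨$⟩ˡ j) l ≢ + 0) (inverseʳ f) (on≢0 (f ⟨$⟩ˡ j))
            , λ i m≢0 → sym (trans (cong (f ⟨$⟩ˡ_) (support m≢0)) (inverseˡ f))

transpose-isSignedMonomial : ∀ {n} {M : Matrix n} → IsSignedMonomial n M → IsSignedMonomial n (transpose M)
transpose-isSignedMonomial (entries , rows , columns) = (λ i j → entries j i) , columns , rows

-- Both sums collapse to a single term. The formula serves both directions between monomial matrices
-- and relabellings.
sandwich : ∀ {n} (P R Q : Matrix n) (f g : Fin n → Fin n) →
           (∀ {i l} → l ≢ f i → P i l ≡ + 0) → (∀ {l j} → l ≢ g j → Q l j ≡ + 0) →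
           ∀ i j → (P ⊗ (R ⊗ Q)) i j ≡ P i (f i) * Q (g j) j * R (f i) (g j)
sandwich {n} P R Q f g P-off Q-off i j = begin
  (P ⊗ (R ⊗ Q)) i j                         ≡⟨ sumFin≡sum n (λ l → P i l * (R ⊗ Q) l j) ⟩
  sum (λ l → P i l * (R ⊗ Q) l j)           ≡⟨ sum-single _ (f i) (λ l l≢ →
                                                 trans (cong (λ p → p * (R ⊗ Q) l j) (P-off l≢)) (ℤ.*-zeroˡ ((R ⊗ Q) l j))) ⟩
  P i (f i) * (R ⊗ Q) (f i) j               ≡⟨ cong (_*_ (P i (f i))) (sumFin≡sum n (λ l → R (f i) l * Q l j)) ⟩
  P i (f i) * sum (λ l → R (f i) l * Q l j) ≡⟨ cong (_*_ (P i (f i))) (sum-single _ (g j) (λ l l≢ →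
                                                 trans (cong (_*_ (R (f i) l)) (Q-off l≢)) (ℤ.*-zeroʳ (R (f i) l)))) ⟩
  P i (f i) * (R (f i) (g j) * Q (g j) j)   ≡⟨ regroup (P i (f i)) (R (f i) (g j)) (Q (g j) j) ⟩
  P i (f i) * Q (g j) j * R (f i) (g j)     ∎
  where
  regroup : ∀ p r q → p * (r * q) ≡ p * q * r
  regroup = solve-∀

relabelling⇒equivalent : ∀ {n} {W R : Matrix n} → SignedRelabelling W R → Equivalent n W R
relabelling⇒equivalent {R = R} rel =
  P , Q , monomial-isSignedMonomial row row-sign-sign
  , transpose-isSignedMonomial (monomial-isSignedMonomial column column-sign-sign)
  , λ i j → trans (entry i j) (sym (trans
      (sandwich P R Q (row ⟨$⟩ʳ_) (column ⟨$⟩ʳ_)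
        (λ l≢ → monomial-off row row-sign (l≢ ∘ sym)) (λ l≢ → monomial-off column column-sign (l≢ ∘ sym)) i j)
      (cong₂ (λ e d → e * d * R (row ⟨$⟩ʳ i) (column ⟨$⟩ʳ j))
        (monomial-on row row-sign i) (monomial-on column column-sign j))))
  where
  open SignedRelabelling rel
  P = monomial row row-sign
  Q = transpose (monomial column column-sign)

module SignedMonomial {n} {M : Matrix n} (monomialM : IsSignedMonomial n M) where

  support : Permutation n n
  support = permutation to from
    (λ j → sym (proj₂ (proj₂ (rows (from j))) j (proj₁ (proj₂ (columns j)))))
    (λ i → sym (proj₂ (proj₂ (columns (to i))) i (proj₁ (proj₂ (rows i)))))
    where
    rows    = proj₁ (proj₂ monomialM)
    columns = proj₂ (proj₂ monomialM)

    to from : Fin n → Fin n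
    to   i = proj₁ (rows i)
    from j = proj₁ (columns j)

  support-sign : ∀ i → IsSign (M i (support ⟨$⟩ʳ i))
  support-sign i = signed (proj₁ monomialM i _) (proj₁ (proj₂ (proj₁ (proj₂ monomialM) i)))

  off-support : ∀ {i j} → j ≢ support ⟨$⟩ʳ i → M i j ≡ + 0
  off-support {i} {j} j≢ with M i j ℤ.≟ + 0
  ... | yes m≡0 = m≡0
  ... | no  m≢0 = contradiction (proj₂ (proj₂ (proj₁ (proj₂ monomialM) i)) j m≢0) j≢

equivalent⇒relabelling : ∀ {n} {W R : Matrix n} → Equivalent n W R → SignedRelabelling W R
equivalent⇒relabelling {R = R} (P , Q , monomialP , monomialQ , W≡PRQ) = record
  { row              = P.support
  ; column           = Q.support
  ; row-sign         = λ i → P i (P.support ⟨$⟩ʳ i)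
  ; column-sign      = λ j → Q (Q.support ⟨$⟩ʳ j) j
  ; row-sign-sign    = P.support-sign
  ; column-sign-sign = Q.support-sign
  ; entry            = λ i j → trans (W≡PRQ i j)
      (sandwich P R Q (P.support ⟨$⟩ʳ_) (Q.support ⟨$⟩ʳ_) P.off-support Q.off-support i j)
  }
  where
  module P = SignedMonomial monomialP
  -- A column `j` is sent to the row of `Q` that holds the nonzero entry of column `j`, hence the
  -- transpose.
  module Q = SignedMonomial (transpose-isSignedMonomial monomialQ)

transpose-relabelling : ∀ {n} {W R : Matrix n} → SignedRelabelling W R →
                        SignedRelabelling (transpose W) (transpose R)
transpose-relabelling {R = R} rel = record
  { row = column ; column = row ; row-sign = column-sign ; column-sign = row-sign
  ; row-sign-sign = column-sign-sign ; column-sign-sign = row-sign-sign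
  ; entry = λ i j → trans (entry j i)
      (cong (λ e → e * R (row ⟨$⟩ʳ j) (column ⟨$⟩ʳ i)) (ℤ.*-comm (row-sign j) (column-sign i)))
  }
  where open SignedRelabelling rel

-- Inequivalence of the representatives

-- Row `k` enters only through its squares, that is, its nonzero columns, and the absolute value
-- removes the signs of rows `i` and `j`. If these rows are orthogonal, it is also the absolute
-- value of their product summed over the zeros of row `k`.
agreement : ∀ {n} → Matrix n → Fin n → Fin n → Fin n → ℕ
agreement M i j k = ∣ sum (λ c → M i c * M j c * (M k c * M k c)) ∣

-- In a weighing matrix of order 12 and weight 10, for rows i and j with disjoint zeros, half of
-- the innermost sum is the number of rows k on whose two zeros the product of rows i and j is
-- constant and nonzero.
invariant : ∀ {n} → Matrix n → ℕ
invariant M = ℕSum.sum λ i → ℕSum.sum λ j → square (ℕSum.sum (agreement M i j))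
  where
  -- Without the square the total would be the same for all weighing matrices of order 12 and weight
  -- 10: on the zero pair of any row `k`, exactly one row of each of the other five pairs has equal
  -- signs, so the number of pairs of rows with constant product there does not depend on the
  -- matrix.
  square : ℕ → ℕ
  square m = m ℕ.* m

module _ {n} {W R : Matrix n} (rel : SignedRelabelling W R) where

  open SignedRelabelling rel

  agreement-relabelling : ∀ i j k →
    agreement W i j k ≡ agreement R (row ⟨$⟩ʳ i) (row ⟨$⟩ʳ j) (row ⟨$⟩ʳ k)
  agreement-relabelling i j k = begin
    agreement W i j k
      ≡⟨ cong ∣_∣ (sum-cong-≗ term) ⟩
    ∣ sum (λ c → s * r (column ⟨$⟩ʳ c)) ∣
      ≡⟨ cong ∣_∣ (*-distribˡ-sum s (r ∘ (column ⟨$⟩ʳ_))) ⟨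
    ∣ s * sum (r ∘ (column ⟨$⟩ʳ_)) ∣
      ≡⟨ ℤ.abs-* s _ ⟩
    ∣ s ∣ ℕ.* ∣ sum (r ∘ (column ⟨$⟩ʳ_)) ∣
      ≡⟨ cong₂ ℕ._*_ (abs-sign (sign-* (row-sign-sign i) (row-sign-sign j))) (cong ∣_∣ (sym (sum-permute r column))) ⟩
    1 ℕ.* ∣ sum r ∣
      ≡⟨ ℕ.*-identityˡ _ ⟩
    agreement R (f i) (f j) (f k) ∎
    where
    f = row ⟨$⟩ʳ_
    s = row-sign i * row-sign j
    r = λ c → R (f i) c * R (f j) c * (R (f k) c * R (f k) c)

    abs-sign : ∀ {x} → IsSign x → ∣ x ∣ ≡ 1
    abs-sign (inj₁ refl) = refl
    abs-sign (inj₂ refl) = refl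

    -- Only the signs of rows `i` and `j` survive; the bracketing lets three uses of `sign-cancel`
    -- remove the other squares one after another.
    regroup : ∀ a b e d x y z →
      a * d * x * (b * d * y) * (e * d * z * (e * d * z)) ≡ (e * e) * ((d * d) * ((d * d) * (a * b * (x * y * (z * z)))))
    regroup = solve-∀

    term : ∀ c → W i c * W j c * (W k c * W k c) ≡ s * r (column ⟨$⟩ʳ c)
    term c = begin
      W i c * W j c * (W k c * W k c)
        ≡⟨ cong₂ (λ x y → x * y) (cong₂ (λ x y → x * y) (entry i c) (entry j c))
                                 (cong₂ (λ x y → x * y) (entry k c) (entry k c)) ⟩
      _ ≡⟨ regroup (row-sign i) (row-sign j) (row-sign k) (column-sign c)
             (R (f i) (column ⟨$⟩ʳ c)) (R (f j) (column ⟨$⟩ʳ c)) (R (f k) (column ⟨$⟩ʳ c)) ⟩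
      _ ≡⟨ sign-cancel _ (row-sign-sign k) ⟩
      _ ≡⟨ sign-cancel _ (column-sign-sign c) ⟩
      _ ≡⟨ sign-cancel _ (column-sign-sign c) ⟩
      s * r (column ⟨$⟩ʳ c) ∎

  invariant-relabelling : invariant W ≡ invariant R
  invariant-relabelling = begin
    invariant W
      ≡⟨ ℕSum.sum-cong-≗ (λ i → ℕSum.sum-cong-≗ λ j → cong (λ m → m ℕ.* m)
           (trans (ℕSum.sum-cong-≗ (agreement-relabelling i j)) (sym (ℕSum.sum-permute (agreement R (f i) (f j)) row)))) ⟩
    ℕSum.sum (λ i → ℕSum.sum λ j → F (f i) (f j))
      ≡⟨ ℕSum.sum-cong-≗ (λ i → sym (ℕSum.sum-permute (F (f i)) row)) ⟩
    ℕSum.sum (λ i → ℕSum.sum (F (f i)))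
      ≡⟨ ℕSum.sum-permute (λ i → ℕSum.sum (F i)) row ⟨
    invariant R ∎
    where
    f = row ⟨$⟩ʳ_

    F : Fin n → Fin n → ℕ
    F i j = ℕSum.sum (agreement R i j) ℕ.* ℕSum.sum (agreement R i j)

profile : ∀ {n} → Matrix n → ℕ × ℕ
profile M = invariant M , invariant (transpose M)

profile-equivalent : ∀ {n} {W R : Matrix n} → Equivalent n W R → profile W ≡ profile R
profile-equivalent {W = W} {R} W~R =
  cong₂ _,_ (invariant-relabelling rel) (invariant-relabelling (transpose-relabelling rel))
  where
  rel : SignedRelabelling W R
  rel = equivalent⇒relabelling W~R

-- The first component alone does not separate the first two or the next two; the transpose does.
-- The second and third profiles are reversed because those representatives are transposes of each
-- other.
profiles : Vec (ℕ × ℕ) 5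
profiles = (135360 , 135360) ∷ (135360 , 129216) ∷ (129216 , 135360) ∷ (129216 , 129216) ∷ (127680 , 127680) ∷ []

profile-representative : ∀ a → profile (representative a) ≡ lookup profiles a
profile-representative zero                         = refl
profile-representative (suc zero)                   = refl
profile-representative (suc (suc zero))             = refl
profile-representative (suc (suc (suc zero)))       = refl
profile-representative (suc (suc (suc (suc zero)))) = refl

profiles-unique : UniqueVec profiles
profiles-unique = from-yes (allPairs? (λ p q → ¬? (≡-dec ℕ._≟_ ℕ._≟_ p q)) profiles)

representatives-inequivalent : ∀ a b → Equivalent 12 (representative a) (representative b) → a ≡ b
representatives-inequivalent a b a~b = UniqueVec.lookup-injective profiles-unique a b (begin
  lookup profiles a            ≡⟨ profile-representative a ⟨
  profile (representative a)   ≡⟨ profile-equivalent {W = representative a} {representative b} a~b ⟩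
  profile (representative b)   ≡⟨ profile-representative b ⟩
  lookup profiles b            ∎)

-- The classification

isWeighing? : ∀ {n} k (W : Matrix n) → Dec (IsWeighing n k W)
isWeighing? k W =
  Fin.all? (λ i → Fin.all? λ j → isSignOrZero? (W i j)) ×-dec
  Fin.all? (λ i → Fin.all? λ j → (W ⊗ transpose W) i j ℤ.≟ scalarId _ (+ k) i j)
  where
  isSignOrZero? : ∀ x → Dec (IsSignOrZero x)
  isSignOrZero? x = (x ℤ.≟ + 1) ⊎-dec (x ℤ.≟ -[1+ 0 ]) ⊎-dec (x ℤ.≟ + 0)

representative-isWeighing : ∀ a → IsWeighing 12 10 (representative a)
representative-isWeighing = from-yes (Fin.all? λ a → isWeighing? 10 (representative a))

pointwise-∈ : ∀ {A B : Set} {R : A → B → Set} {xs ys x} → Pointwise R xs ys → x ∈ xs → ∃ λ y → R x y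
pointwise-∈ (r ∷ _)  (here refl) = _ , r
pointwise-∈ (_ ∷ rs) (there x∈)  = pointwise-∈ rs x∈

-- The normalisation of `W` and the certificate for the representative arrive at the same matrix, so
-- the first is undone and the second applied. Signs are their own inverses, hence simply multiply.
normalForm-relabelling : ∀ {W} {R : Vec (Vec ℤ 12) 12} (N : NormalForm W) {rs cs es ds} →
  Transforms R (tabulate₂ (NormalForm.entry N)) rs cs es ds →
  SignedRelabelling W (λ i j → lookup (lookup R i) j)
normalForm-relabelling {W} {R} N {rs} {cs} {es} {ds} T = record
  { row              = flip rowW ∘ₚ rowR
  ; column           = flip columnW ∘ₚ columnR
  ; row-sign         = λ i → N.row-sign (rowW ⟨$⟩ˡ i) * lookup es (rowW ⟨$⟩ˡ i)
  ; column-sign      = λ j → N.column-sign (columnW ⟨$⟩ˡ j) * lookup ds (columnW ⟨$⟩ˡ j)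
  ; row-sign-sign    = λ i → sign-* (N.row-sign-sign _) (T.row-signs _)
  ; column-sign-sign = λ j → sign-* (N.column-sign-sign _) (T.column-signs _)
  ; entry            = λ i j → trans (sym (cong₂ W (inverseʳ rowW) (inverseʳ columnW)))
                                     (entry (rowW ⟨$⟩ˡ i) (columnW ⟨$⟩ˡ j))
  }
  where
  module N = NormalForm N
  module T = Transforms T

  rowW    = injective⇒permutation N.row N.row-injective
  columnW = injective⇒permutation N.column N.column-injective
  rowR    = injective⇒permutation (lookup rs) (UniqueVec.lookup-injective T.rows-unique _ _)
  columnR = injective⇒permutation (lookup cs) (UniqueVec.lookup-injective T.columns-unique _ _)

  regroup₁ : ∀ e d w → (e * e) * ((d * d) * w) ≡ e * d * (e * d * w)
  regroup₁ = solve-∀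

  regroup₂ : ∀ e d e′ d′ r → e * d * (e′ * d′ * r) ≡ e * e′ * (d * d′) * r
  regroup₂ = solve-∀

  entry : ∀ i j → W (N.row i) (N.column j) ≡
    N.row-sign i * lookup es i * (N.column-sign j * lookup ds j) * lookup (lookup R (lookup rs i)) (lookup cs j)
  entry i j = begin
    W (N.row i) (N.column j)
      ≡⟨ sign-cancel _ (N.column-sign-sign j) ⟨
    (N.column-sign j * N.column-sign j) * W (N.row i) (N.column j)
      ≡⟨ sign-cancel _ (N.row-sign-sign i) ⟨
    (N.row-sign i * N.row-sign i) * ((N.column-sign j * N.column-sign j) * W (N.row i) (N.column j))
      ≡⟨ regroup₁ (N.row-sign i) (N.column-sign j) _ ⟩
    N.row-sign i * N.column-sign j * N.entry i j
      ≡⟨ cong (_*_ (N.row-sign i * N.column-sign j)) (begin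
           N.entry i j                                              ≡⟨ lookup-tabulate₂ N.entry i j ⟨
           lookup (lookup (tabulate₂ N.entry) i) j                  ≡⟨ cong (λ L → lookup (lookup L i) j) T.agrees ⟩
           lookup (lookup (scale es ds (gather R rs cs)) i) j       ≡⟨ lookup-scale-gather es ds R rs cs i j ⟩
           lookup es i * lookup ds j * lookup (lookup R (lookup rs i)) (lookup cs j) ∎) ⟩
    N.row-sign i * N.column-sign j * (lookup es i * lookup ds j * lookup (lookup R (lookup rs i)) (lookup cs j))
      ≡⟨ regroup₂ (N.row-sign i) (N.column-sign j) (lookup es i) (lookup ds j) _ ⟩
    N.row-sign i * lookup es i * (N.column-sign j * lookup ds j) * lookup (lookup R (lookup rs i)) (lookup cs j) ∎

classified : ∀ W → IsWeighing 12 10 W → ∃ λ a → Equivalent 12 W (representative a)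
classified W weighing = conclude (pointwise-∈ certified
  (∈-matrices (λ i j → choice (index i) (index j))
    (NormalForm.entry N) (NormalForm.entry-choice N) (NormalForm.orthogonal N)))
  where
  N : NormalForm W
  N = Normalise.normalForm weighing

  conclude : (∃ λ n → Certifies (tabulate₂ (NormalForm.entry N)) n) → ∃ λ a → Equivalent 12 W (representative a)
  conclude (n , T) = class n , relabelling⇒equivalent (normalForm-relabelling N T)

theorem5p5 : Σ (Fin 5 → Matrix 12) λ Ws →
    (∀ a → IsWeighing 12 10 (Ws a)) ×
    (∀ a b → Equivalent 12 (Ws a) (Ws b) → a ≡ b) ×
    (∀ W → IsWeighing 12 10 W → ∃ λ a → Equivalent 12 W (Ws a))
theorem5p5 = representative , representative-isWeighing , representatives-inequivalent , classified
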